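{- Let $m\ge 3$ and $l\ge 1$ be integers, and let $L(\mathrm{Tp}_{m,l})$ be the graph obtained from the disjoint union of a cycle $C_m$ on $m$ vertices and a path $P_l$ on $l$ vertices by adding the edges $uw$ and $vw$, where $u,v$ are two adjacent vertices of $C_m$ and $w$ is an end of $P_l$. Then $L(\mathrm{Tp}_{m,l})$ is $e$-positive.
   Context: For a finite simple graph $G$, the chromatic symmetric function is $X_G=\sum_\kappa\prod_{v\in V(G)}x_{\kappa(v)}$, where $x_1,x_2,\dots$ are commuting indeterminates and the sum is over all proper colorings $\kappa\colon V(G)\to\{1,2,3,\dots\}$. With $e_n=\sum_{1\le i_1<\dots<i_n}x_{i_1}\dotsm x_{i_n}$ and $e_\lambda=e_{\lambda_1}e_{\lambda_2}\dotsm$ for integer partitions $\lambda$, the $e_\lambda$ form a basis of the algebra of symmetric functions. The graph $G$ is called $e$-positive if all coefficients of $X_G$ in the basis $\{e_\lambda\}$ are nonnegative. The graph $L(\mathrm{Tp}_{m,l})$ is the line graph of the tadpole $\mathrm{Tp}_{m,l}$ consisting of a cycle of length $m$ with a pendant path having $l$ edges attached at one vertex of the cycle. -}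

module Defs where

open import Data.Bool.Base using (if_then_else_)
open import Data.Fin.Base using (Fin; toℕ; splitAt; _↑ˡ_; _↑ʳ_)
open import Data.Fin.Properties using (all?) renaming (_≟_ to _≟ᶠ_)
open import Data.Integer.Base as ℤ using (ℤ; +_; 0ℤ; 1ℤ)
open import Data.List.Base
  using (List; []; _∷_; length; map; foldr; filter; upTo; cartesianProductWith)
open import Data.List.Properties using (≡-dec)
open import Data.List.Relation.Unary.All as All using (All)
open import Data.List.Relation.Unary.Linked using (Linked)
open import Data.List.Relation.Unary.Unique.Propositional using (Unique)
open import Data.Nat.Base using (ℕ; zero; suc; _+_; _∸_; _<_; _≥_)
open import Data.Nat.Properties using (_≟_; _<?_)
open import Data.Product.Base using (_×_; _,_; proj₁; proj₂; ∃-syntax)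
open import Data.Sum.Base as Sum using (_⊎_)
open import Data.Sum.Relation.Binary.Pointwise using (Pointwise; ⊎-decidable)
open import Data.Vec.Base as Vec using (Vec; []; _∷_; lookup)
import Data.Vec.Relation.Unary.Linked as Vecᴸ
open import Level using (0ℓ)
open import Relation.Binary.Core using (Rel)
import Relation.Binary.Definitions as B
open import Relation.Binary.PropositionalEquality using (_≡_; _≢_; refl; sym)
open import Relation.Nullary using (¬_; does; ¬?; _×-dec_; _⊎-dec_; _→-dec_)
open import Relation.Unary using (Pred; Decidable)

private
  variable
    m n : ℕ

------------------------------------------------------------------------
-- Finite simple graphs

record SimpleGraph (n : ℕ) : Set₁ where
  infix 4 _~_ _~?_
  field
    _~_      : Rel (Fin n) 0ℓ
    _~?_     : B.Decidable _~_
    ~-sym    : B.Symmetric _~_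
    ~-irrefl : ∀ {u} → ¬ (u ~ u)

-- The simple graph whose edges are the pairs {u , v}, u ≢ v, with E u v
-- or E v u.
fromRel : (E : Rel (Fin n) 0ℓ) → B.Decidable E → SimpleGraph n
fromRel E E? = record
  { _~_      = λ u v → u ≢ v × (E u v ⊎ E v u)
  ; _~?_     = λ u v → ¬? (u ≟ᶠ v) ×-dec (E? u v ⊎-dec E? v u)
  ; ~-sym    = λ (u≢v , e) → (λ v≡u → u≢v (sym v≡u)) , Sum.swap e
  ; ~-irrefl = λ (u≢u , _) → u≢u refl
  }

path : ∀ l → SimpleGraph l
path l = fromRel (λ i j → suc (toℕ i) ≡ toℕ j) (λ i j → suc (toℕ i) ≟ toℕ j)

IsEnd : ∀ {l} → Fin l → Set
IsEnd {l} w = toℕ w ≡ 0 ⊎ suc (toℕ w) ≡ l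

cycle : ∀ m → SimpleGraph m
cycle m = fromRel
  (λ i j → suc (toℕ i) ≡ toℕ j ⊎ (suc (toℕ i) ≡ m × toℕ j ≡ 0))
  (λ i j → (suc (toℕ i) ≟ toℕ j) ⊎-dec ((suc (toℕ i) ≟ m) ×-dec (toℕ j ≟ 0)))

-- The vertices of G are the u ↑ˡ n, those of H are the m ↑ʳ v.
infixl 6 _⊔ᴳ_
_⊔ᴳ_ : SimpleGraph m → SimpleGraph n → SimpleGraph (m + n)
_⊔ᴳ_ {m} G H = fromRel
  (λ x y → Pointwise G._~_ H._~_ (splitAt m x) (splitAt m y))
  (λ x y → ⊎-decidable G._~?_ H._~?_ (splitAt m x) (splitAt m y))
  where
  module G = SimpleGraph G
  module H = SimpleGraph H

addEdge : SimpleGraph n → Fin n → Fin n → SimpleGraph n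
addEdge G a b = fromRel (λ x y → x ~ y ⊎ (x ≡ a × y ≡ b))
                        (λ x y → (x ~? y) ⊎-dec ((x ≟ᶠ a) ×-dec (y ≟ᶠ b)))
  where open SimpleGraph G

lineTadpole : ∀ m l → (u v : Fin m) (w : Fin l) → SimpleGraph (m + l)
lineTadpole m l u v w =
  addEdge (addEdge (cycle m ⊔ᴳ path l) (u ↑ˡ l) (m ↑ʳ w)) (v ↑ˡ l) (m ↑ʳ w)

------------------------------------------------------------------------
-- Formal power series over ℤ in x₀, x₁, x₂, …

-- The list a₀ ∷ a₁ ∷ … ∷ [] stands for ∏ᵢ xᵢ^aᵢ; trailing zeros do not change the
-- monomial, and all the series built below respect this.
Monomial : Set
Monomial = List ℕ

Series : Set
Series = Monomial → ℤ

infix 4 _≈_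
_≈_ : Rel Series 0ℓ
f ≈ g = ∀ α → f α ≡ g α

sumℤ : List ℤ → ℤ
sumℤ = foldr ℤ._+_ 0ℤ

0ˢ 1ˢ : Series
0ˢ _ = 0ℤ
1ˢ α = if does (All.all? (_≟ 0) α) then 1ℤ else 0ℤ

infixl 6 _+ˢ_
infixl 7 _*ˢ_ _•_

_+ˢ_ : Series → Series → Series
(f +ˢ g) α = f α ℤ.+ g α

_•_ : ℤ → Series → Series
(c • f) α = c ℤ.* f α

-- All pairs (β , γ) with β + γ = α componentwise.
splits : Monomial → List (Monomial × Monomial)
splits []      = ([] , []) ∷ []
splits (a ∷ α) =
  cartesianProductWith (λ i (β , γ) → i ∷ β , (a ∸ i) ∷ γ) (upTo (suc a)) (splits α)

_*ˢ_ : Series → Series → Series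
(f *ˢ g) α = sumℤ (map (λ (β , γ) → f β ℤ.* g γ) (splits α))

-- All words of length n in the letters 0, …, k − 1.
words : (k n : ℕ) → List (Vec ℕ n)
words k zero    = [] ∷ []
words k (suc n) = cartesianProductWith _∷_ (upTo k) (words k n)

-- The monomial ∏ᵢ x_{wᵢ}, for a word w in the letters 0, …, k − 1.
wordMonomial : (k : ℕ) → Vec ℕ n → Monomial
wordMonomial k w = map (λ c → Vec.count (c ≟_) w) (upTo k)

-- The sum of the monomials ∏ᵢ x_{wᵢ} over all words w ∈ ℕⁿ satisfying P.
-- A word contributing to the coefficient of α has all its letters below
-- length α, so that coefficient is a finite count.
Σwords : {P : Pred (Vec ℕ n) 0ℓ} → Decidable P → Series
Σwords {n} P? α = + length (filter
  (λ w → P? w ×-dec ≡-dec _≟_ (wordMonomial (length α) w) α)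
  (words (length α) n))

------------------------------------------------------------------------
-- Elementary symmetric functions

e : ℕ → Series
e n = Σwords {n} (Vecᴸ.linked? _<?_)

record Partition : Set where
  constructor mkPartition
  field
    parts       : List ℕ
    .decreasing : Linked _≥_ parts
    .positive   : All (0 <_) parts

open Partition public

eᴾ : Partition → Series
eᴾ λ′ = foldr (λ i f → e i *ˢ f) 1ˢ (parts λ′)

linearCombination : List (ℤ × Partition) → Series
linearCombination = foldr (λ (c , λ′) f → c • eᴾ λ′ +ˢ f) 0ˢ

------------------------------------------------------------------------
-- Chromatic symmetric functions

Proper : SimpleGraph n → Pred (Vec ℕ n) 0ℓ
Proper G κ = ∀ u v → u ~ v → lookup κ u ≢ lookup κ v
  where open SimpleGraph G

proper? : (G : SimpleGraph n) → Decidable (Proper G)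
proper? G κ = all? λ u → all? λ v → (u ~? v) →-dec ¬? (lookup κ u ≟ lookup κ v)
  where open SimpleGraph G

X : SimpleGraph n → Series
X G = Σwords (proper? G)

-- The listed partitions are distinct, so the listed integers are the
-- coefficients of X G in the basis eᴾ; all coefficients not listed are 0.
EPositive : SimpleGraph n → Set
EPositive G = ∃[ ts ] Unique (map proj₂ ts)
                    × X G ≈ linearCombination ts
                    × All (λ (c , _) → 0ℤ ℤ.≤ c) ts

{-# OPTIONS --safe #-}
module Submission where

-- For a family F of series indexed by the letters, let ∫ F = Σ_c x_c F(c), and let
-- (A f)(r) = ∫_s [r ≠ s] f(s). Then L_k = A^k 1 counts the colourings of a path with k
-- further vertices by the colour of its first vertex, and M_j(r, d) = A^j [· ≠ d] (r) the
-- walks from r to d with j inner vertices, so that paths are P = ∫ L, cycles C = ∫ M(r, r)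
-- and tadpoles T = ∫ M(r, r) L(r).
--
-- Let E_n(d) be e_n without the variable x_d. From ∫ E_n = (n + 1) e_{n+1} one gets
-- A E_n = E_{n+1} + n e_{n+1}, which expands all integrals ∫ E_i L_k, in particular the
-- paths, with nonnegative coefficients. Comparing a disjoint cycle and path with a long path
-- gives C_m P_l + T_{m+1,l-1} = T_{m,l} + P_{m+l}, and then induction on m gives
--   T_{m,l} = Σ_{i<m} (i - 1) e_i T_{m-i,l} + (m - 1) ∫ E_{m-1} L_l.
-- The colourings of the triangle u v w show that the line graph of the tadpole has
-- X = 2 T_{m,l} - C_m P_l =: Y_m; by the above it satisfies
--   Y_m = Σ_{i<m} (i - 1) e_i Y_{m-i} + (m - 1) ((m - 2) e_m P_l + 2 ∫ E_m L_{l-1}).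

open import Algebra.Bundles using (CommutativeRing; RawRing)
import Algebra.Construct.Pointwise as Pointwise
open import Algebra.Solver.Ring.AlmostCommutativeRing
  using (_-Raw-AlmostCommutative⟶_; fromCommutativeRing)
open import Data.Bool.Base using (Bool; true; false; if_then_else_; not; _∧_)
open import Data.Fin.Base using (Fin; zero; suc; toℕ; _↑ˡ_; _↑ʳ_; splitAt)
open import Data.Fin.Properties as Finₚ using (toℕ<n)
open import Data.Integer.Base as ℤ using (ℤ; 0ℤ; 1ℤ; +_)
import Data.Integer.Properties as ℤₚ
open import Data.List.Base as List
  using (List; []; _∷_; map; applyUpTo; upTo; cartesianProductWith; length; filter)
open import Data.List.Properties as Listₚ using (map-++; ≡-dec)
open import Data.List.Relation.Binary.Permutation.Propositional using (↭-sym)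
open import Data.List.Relation.Binary.Permutation.Propositional.Properties using (All-resp-↭)
open import Data.List.Relation.Unary.All as All using (All; []; _∷_)
import Data.List.Relation.Unary.All.Properties as Allₚ
open import Data.List.Relation.Unary.AllPairs using ([]; _∷_)
open import Data.List.Relation.Unary.Linked using ([])
open import Data.List.Relation.Unary.Unique.Propositional using (Unique)
import Data.List.Sort.InsertionSort.Base as InsertionSort
import Data.List.Sort.InsertionSort.Properties as InsertionSortₚ
open import Data.Maybe.Base using (Maybe; just; nothing)
open import Data.Nat.Base as ℕ using (ℕ; zero; suc; _≤_)
open import Data.Nat.Induction using (<-rec)
open import Data.Nat.Properties as ℕₚ using (_≟_; _≤?_; _<?_)
open import Data.Product.Base using (_×_; _,_; proj₁; proj₂; ∃-syntax)
open import Data.Sum.Base using (_⊎_; inj₁; inj₂)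
open import Data.Sum.Relation.Binary.Pointwise using (Pointwise; inj₁; inj₂)
open import Data.Unit.Base using (⊤; tt)
open import Data.Vec.Base as Vec using (Vec; []; _∷_; _++_; lookup)
open import Data.Vec.Properties using (lookup-++ˡ; lookup-++ʳ)
import Data.Vec.Relation.Unary.Linked as Vecᴸ
open import Function.Base using (_∘_; id)
open import Function.Bundles using (_⇔_; mk⇔; Equivalence)
open import Level using (0ℓ; _⊔_)
import Relation.Binary.Construct.Flip.EqAndOrd as Flip
open import Relation.Binary.Definitions using (tri<; tri≈; tri>)
open import Relation.Binary.PropositionalEquality as ≡ using (_≡_; _≢_; ≢-sym)
open import Relation.Nullary using (Dec; yes; no; does; ¬?; _×-dec_)
open import Relation.Nullary.Decidable using (dec-true; dec-false; does-⇔)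
open import Relation.Unary using (Pred; Decidable)

-- The difference 2 T - C P is not visibly e-positive. It can be controlled because the tadpoles
-- with a fixed path and the products of a cycle with that path obey recurrences with the same
-- weights (i - 1) e_i. The difference then obeys one too, and only the inhomogeneous terms need
-- comparing: they leave 2 (m - 1)^2 - m (m - 1) = (m - 1)(m - 2) copies of e_m P_l. All sums over
-- colours are infinite. The combinatorial half therefore works in any commutative ring with an
-- operator `∫` that is linear and satisfies Fubini; even the variable x_d is obtained as
-- `∫ (λ c → eq c d)`. Power series supply an instance, and only there are coefficients and
-- finiteness considered. Indices are shifted in the code: a cycle or path of index k has k + 1
-- vertices, so m corresponds to `j` = m - 1.

Walk : ∀ {n} → ℕ → Vec ℕ n → ℕ → Set
Walk r []      s = r ≢ s
Walk r (c ∷ w) s = r ≢ c × Walk c w s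

Link : ∀ {n} → ℕ → Vec ℕ n → Set
Link r []      = ⊤
Link r (c ∷ w) = r ≢ c × Link c w

walk? : ∀ {n} r (w : Vec ℕ n) s → Dec (Walk r w s)
walk? r []      s = ¬? (r ≟ s)
walk? r (c ∷ w) s = ¬? (r ≟ c) ×-dec walk? c w s

link? : ∀ {n} r (w : Vec ℕ n) → Dec (Link r w)
link? r []      = yes tt
link? r (c ∷ w) = ¬? (r ≟ c) ×-dec link? c w

ConsecutiveOnCycle : ∀ {m} → Fin m → Fin m → Set
ConsecutiveOnCycle {m} u v = suc (toℕ u) ≡ toℕ v ⊎ (suc (toℕ u) ≡ m × toℕ v ≡ 0)

-- The ring solver with integer coefficients; the pair (a , b) stands for a − b.
module IntegerCoefficients {c ℓ} (R : CommutativeRing c ℓ) where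
  open CommutativeRing R
  open import Algebra.Properties.Semiring.Mult.TCOptimised semiring
    renaming (_×_ to _·_)
  open import Relation.Binary.Reasoning.Setoid setoid
  open import Algebra.Properties.Group +-group using (∙-cancelʳ)
  import Algebra.Solver.Ring.NaturalCoefficients.Default commutativeSemiring as ℕ-Solver

  Coefficient : Set
  Coefficient = ℕ × ℕ

  0ᶜ 1ᶜ : Coefficient
  0ᶜ = 0 , 0
  1ᶜ = 1 , 0

  -- The solver compares coefficients in normal forms syntactically.
  reduce : Coefficient → Coefficient
  reduce (a , b) = a ℕ.∸ b , b ℕ.∸ a

  coefficients : RawRing _ _
  coefficients = record
    { Carrier = Coefficient
    ; _≈_     = _≡_
    ; _+_     = λ (a , b) (a′ , b′) → reduce (a ℕ.+ a′ , b ℕ.+ b′)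
    ; _*_     = λ (a , b) (a′ , b′) → reduce (a ℕ.* a′ ℕ.+ b ℕ.* b′ , a ℕ.* b′ ℕ.+ b ℕ.* a′)
    ; -_      = λ (a , b) → b , a
    ; 0#      = 0ᶜ
    ; 1#      = 1ᶜ
    }

  private
    module K = RawRing coefficients
    module S = ℕ-Solver

    -- The clause for b = 0 makes ⟦ 0ᶜ ⟧ and ⟦ 1ᶜ ⟧ compute to 0# and 1#.
    ⟦_⟧ : Coefficient → Carrier
    ⟦ a , zero ⟧  = a · 1#
    ⟦ a , suc b ⟧ = a · 1# - suc b · 1#

    ⟦⟧-difference : ∀ p → ⟦ p ⟧ + proj₂ p · 1# ≈ proj₁ p · 1#
    ⟦⟧-difference (a , zero)  = +-identityʳ _
    ⟦⟧-difference (a , suc b) = begin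
      a · 1# - suc b · 1# + suc b · 1#   ≈⟨ +-assoc _ _ _ ⟩
      a · 1# + (- (suc b · 1#) + suc b · 1#) ≈⟨ +-congˡ (-‿inverseˡ _) ⟩
      a · 1# + 0# ≈⟨ +-identityʳ _ ⟩
      a · 1# ∎

    -- Trading subtraction for an equation with `proj₂ p · 1#` added lets sums and products of
    -- coefficients be treated by the solver over natural coefficients.
    ⟦⟧-unique : ∀ p {z} → z + proj₂ p · 1# ≈ proj₁ p · 1# → ⟦ p ⟧ ≈ z
    ⟦⟧-unique p h = ∙-cancelʳ _ _ _ (trans (⟦⟧-difference p) (sym h))

    -- Both sides are the maximum of `a` and `b`.
    +-∸-swap : ∀ a b → a ℕ.+ (b ℕ.∸ a) ≡ b ℕ.+ (a ℕ.∸ b)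
    +-∸-swap zero    b       rewrite ℕₚ.0∸n≡0 b = ≡.sym (ℕₚ.+-identityʳ b)
    +-∸-swap (suc a) zero    = ℕₚ.+-identityʳ (suc a)
    +-∸-swap (suc a) (suc b) = ≡.cong suc (+-∸-swap a b)

    ⟦⟧-reduce : ∀ p {z} → z + proj₂ p · 1# ≈ proj₁ p · 1# → ⟦ reduce p ⟧ ≈ z
    ⟦⟧-reduce (a , b) {z} h = ⟦⟧-unique (reduce (a , b)) (∙-cancelʳ (b · 1#) _ _ (begin
      z + (b ℕ.∸ a) · 1# + b · 1#
        ≈⟨ S.solve 3 (λ z c b → z S.:+ c S.:+ b S.:= z S.:+ b S.:+ c) refl _ _ _ ⟩
      z + b · 1# + (b ℕ.∸ a) · 1#   ≈⟨ +-congʳ h ⟩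
      a · 1# + (b ℕ.∸ a) · 1#       ≈⟨ ×-homo-+ 1# a _ ⟨
      (a ℕ.+ (b ℕ.∸ a)) · 1#        ≡⟨ ≡.cong (_· 1#) (+-∸-swap a b) ⟩
      (b ℕ.+ (a ℕ.∸ b)) · 1#        ≈⟨ ×-homo-+ 1# b _ ⟩
      b · 1# + (a ℕ.∸ b) · 1#       ≈⟨ +-comm _ _ ⟩
      (a ℕ.∸ b) · 1# + b · 1#       ∎))

    +-homo : ∀ p q → ⟦ p K.+ q ⟧ ≈ ⟦ p ⟧ + ⟦ q ⟧
    +-homo p@(a , b) q@(a′ , b′) = ⟦⟧-reduce (a ℕ.+ a′ , b ℕ.+ b′) (begin
      ⟦ p ⟧ + ⟦ q ⟧ + (b ℕ.+ b′) · 1# ≈⟨ +-congˡ (×-homo-+ 1# b b′) ⟩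
      ⟦ p ⟧ + ⟦ q ⟧ + (b · 1# + b′ · 1#)
        ≈⟨ S.solve 4 (λ p q b b′ → p S.:+ q S.:+ (b S.:+ b′) S.:= (p S.:+ b) S.:+ (q S.:+ b′)) refl _ _ _ _ ⟩
      ⟦ p ⟧ + b · 1# + (⟦ q ⟧ + b′ · 1#) ≈⟨ +-cong (⟦⟧-difference p) (⟦⟧-difference q) ⟩
      a · 1# + a′ · 1# ≈⟨ ×-homo-+ 1# a a′ ⟨
      (a ℕ.+ a′) · 1# ∎)

    ×1-homo : ∀ a b c d → (a ℕ.* b ℕ.+ c ℕ.* d) · 1# ≈ (a · 1#) * (b · 1#) + (c · 1#) * (d · 1#)
    ×1-homo a b c d = trans (×-homo-+ 1# (a ℕ.* b) (c ℕ.* d)) (+-cong (×1-homo-* a b) (×1-homo-* c d))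

    *-homo : ∀ p q → ⟦ p K.* q ⟧ ≈ ⟦ p ⟧ * ⟦ q ⟧
    *-homo p@(a , b) q@(a′ , b′) = ⟦⟧-reduce (a ℕ.* a′ ℕ.+ b ℕ.* b′ , a ℕ.* b′ ℕ.+ b ℕ.* a′) (begin
      ⟦ p ⟧ * ⟦ q ⟧ + (a ℕ.* b′ ℕ.+ b ℕ.* a′) · 1# ≈⟨ +-congˡ (×1-homo a b′ b a′) ⟩
      ⟦ p ⟧ * ⟦ q ⟧ + (a · 1# * b′ · 1# + b · 1# * a′ · 1#)
        ≈⟨ +-congˡ (+-cong (*-congʳ (⟦⟧-difference p)) (*-congˡ (⟦⟧-difference q))) ⟨
      ⟦ p ⟧ * ⟦ q ⟧ + ((⟦ p ⟧ + b · 1#) * b′ · 1# + b · 1# * (⟦ q ⟧ + b′ · 1#))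
        ≈⟨ S.solve 4 (λ p q b b′ → p S.:* q S.:+ ((p S.:+ b) S.:* b′ S.:+ b S.:* (q S.:+ b′))
             S.:= (p S.:+ b) S.:* (q S.:+ b′) S.:+ b S.:* b′) refl _ _ _ _ ⟩
      (⟦ p ⟧ + b · 1#) * (⟦ q ⟧ + b′ · 1#) + b · 1# * b′ · 1#
        ≈⟨ +-congʳ (*-cong (⟦⟧-difference p) (⟦⟧-difference q)) ⟩
      a · 1# * a′ · 1# + b · 1# * b′ · 1# ≈⟨ ×1-homo a a′ b b′ ⟨
      (a ℕ.* a′ ℕ.+ b ℕ.* b′) · 1# ∎)

    -‿homo : ∀ p → ⟦ K.- p ⟧ ≈ - ⟦ p ⟧
    -‿homo p@(a , b) = ⟦⟧-unique (K.- p) (begin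
      - ⟦ p ⟧ + a · 1# ≈⟨ +-congˡ (⟦⟧-difference p) ⟨
      - ⟦ p ⟧ + (⟦ p ⟧ + b · 1#) ≈⟨ +-assoc _ _ _ ⟨
      - ⟦ p ⟧ + ⟦ p ⟧ + b · 1# ≈⟨ +-congʳ (-‿inverseˡ _) ⟩
      0# + b · 1# ≈⟨ +-identityˡ _ ⟩
      b · 1# ∎)

    morphism : coefficients -Raw-AlmostCommutative⟶ fromCommutativeRing R
    morphism = record
      { ⟦_⟧ = ⟦_⟧ ; +-homo = +-homo ; *-homo = *-homo ; -‿homo = -‿homo ; 0-homo = refl ; 1-homo = refl }

    _coeff≟_ : ∀ p q → Maybe (⟦ p ⟧ ≈ ⟦ q ⟧)
    p@(a , b) coeff≟ q@(a′ , b′) with a ℕ.+ b′ ≟ a′ ℕ.+ b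
    ... | no _   = nothing
    ... | yes eq = just (⟦⟧-unique p (∙-cancelʳ (b′ · 1#) _ _ (begin
      ⟦ q ⟧ + b · 1# + b′ · 1#
        ≈⟨ S.solve 3 (λ q b b′ → q S.:+ b S.:+ b′ S.:= (q S.:+ b′) S.:+ b) refl _ _ _ ⟩
      ⟦ q ⟧ + b′ · 1# + b · 1# ≈⟨ +-congʳ (⟦⟧-difference q) ⟩
      a′ · 1# + b · 1#         ≈⟨ ×-homo-+ 1# a′ b ⟨
      (a′ ℕ.+ b) · 1#          ≡⟨ ≡.cong (_· 1#) eq ⟨
      (a ℕ.+ b′) · 1#          ≈⟨ ×-homo-+ 1# a b′ ⟩
      a · 1# + b′ · 1#         ∎)))

  open import Algebra.Solver.Ring coefficients (fromCommutativeRing R) morphism _coeff≟_ public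
    using (solve; con; _:+_; _:*_; _:-_; :-_; _:=_)

-- Weighted sums over colours, given by axioms

record Integral {c ℓ} (R : CommutativeRing c ℓ) : Set (c ⊔ ℓ) where
  open CommutativeRing R
  field
    ∫      : (ℕ → Carrier) → Carrier
    ∫-cong : ∀ {f g} → (∀ c → f c ≈ g c) → ∫ f ≈ ∫ g
    ∫-+    : ∀ f g → ∫ (λ c → f c + g c) ≈ ∫ f + ∫ g
    *-∫    : ∀ a f → a * ∫ f ≈ ∫ (λ c → a * f c)
    ∫-swap : ∀ (h : ℕ → ℕ → Carrier) → ∫ (λ c → ∫ (λ d → h c d)) ≈ ∫ (λ d → ∫ (λ c → h c d))

module Integration {c ℓ} (R : CommutativeRing c ℓ) (I : Integral R) where
  open CommutativeRing R
  open Integral I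
  open import Relation.Binary.Reasoning.Setoid setoid
  open import Algebra.Properties.Group +-group using (∙-cancelˡ)

  open IntegerCoefficients R

  infix 9 #_
  #_ : ℕ → Carrier
  # zero  = 0#
  # suc n = 1# + # n

  ∫-*ˡ : ∀ a f → ∫ (λ c → a * f c) ≈ a * ∫ f
  ∫-*ˡ a f = sym (*-∫ a f)

  ∫-*ʳ : ∀ f a → ∫ (λ c → f c * a) ≈ ∫ f * a
  ∫-*ʳ f a = begin
    ∫ (λ c → f c * a) ≈⟨ ∫-cong (λ c → *-comm (f c) a) ⟩
    ∫ (λ c → a * f c) ≈⟨ ∫-*ˡ a f ⟩
    a * ∫ f           ≈⟨ *-comm a (∫ f) ⟩
    ∫ f * a           ∎

  ∫-0 : ∫ (λ _ → 0#) ≈ 0#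
  ∫-0 = begin
    ∫ (λ _ → 0#)      ≈⟨ ∫-cong (λ _ → sym (zeroˡ 0#)) ⟩
    ∫ (λ _ → 0# * 0#) ≈⟨ ∫-*ˡ 0# (λ _ → 0#) ⟩
    0# * ∫ (λ _ → 0#) ≈⟨ zeroˡ _ ⟩
    0#                ∎

  ⟨_⟩ : Bool → Carrier
  ⟨ b ⟩ = if b then 1# else 0#

  ⟨∧⟩ : ∀ b b′ → ⟨ b ∧ b′ ⟩ ≈ ⟨ b ⟩ * ⟨ b′ ⟩
  ⟨∧⟩ true  b′ = sym (*-identityˡ _)
  ⟨∧⟩ false b′ = sym (zeroˡ _)

  eq neq le : ℕ → ℕ → Carrier
  eq  c d = ⟨ does (c ≟ d) ⟩
  neq c d = ⟨ not (does (c ≟ d)) ⟩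
  le  c d = ⟨ does (c ≤? d) ⟩

  private
    ⟨⟩-cong : ∀ {b b′} → b ≡ b′ → ⟨ b ⟩ ≈ ⟨ b′ ⟩
    ⟨⟩-cong ≡.refl = refl

  eq-yes : ∀ {c d} → c ≡ d → eq c d ≈ 1#
  eq-yes p = ⟨⟩-cong (dec-true (_ ≟ _) p)

  eq-no : ∀ {c d} → c ≢ d → eq c d ≈ 0#
  eq-no p = ⟨⟩-cong (dec-false (_ ≟ _) p)

  neq-no : ∀ {c d} → c ≡ d → neq c d ≈ 0#
  neq-no p = ⟨⟩-cong (≡.cong not (dec-true (_ ≟ _) p))

  neq-yes : ∀ {c d} → c ≢ d → neq c d ≈ 1#
  neq-yes p = ⟨⟩-cong (≡.cong not (dec-false (_ ≟ _) p))

  le-yes : ∀ {c d} → c ℕ.≤ d → le c d ≈ 1#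
  le-yes p = ⟨⟩-cong (dec-true (_ ≤? _) p)

  le-no : ∀ {c d} → d ℕ.< c → le c d ≈ 0#
  le-no p = ⟨⟩-cong (dec-false (_ ≤? _) (ℕₚ.<⇒≱ p))

  neq+eq : ∀ c d → neq c d + eq c d ≈ 1#
  neq+eq c d with c ≟ d
  ... | yes p = trans (+-cong (neq-no p) (eq-yes p)) (+-identityˡ 1#)
  ... | no ¬p = trans (+-cong (neq-yes ¬p) (eq-no ¬p)) (+-identityʳ 1#)

  neq-sym : ∀ c d → neq c d ≈ neq d c
  neq-sym c d with c ≟ d
  ... | yes p = trans (neq-no p) (sym (neq-no (≡.sym p)))
  ... | no ¬p = trans (neq-yes ¬p) (sym (neq-yes (¬p ∘ ≡.sym)))

  eq-subst : ∀ (f : ℕ → Carrier) c d → eq c d * f c ≈ eq c d * f d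
  eq-subst f c d with c ≟ d
  ... | yes ≡.refl = refl
  ... | no ¬p = trans (*-congʳ (eq-no ¬p)) (trans (zeroˡ _) (sym (trans (*-congʳ (eq-no ¬p)) (zeroˡ _))))

  x : ℕ → Carrier
  x d = ∫ (λ c → eq c d)

  ∫-eq : ∀ f d → ∫ (λ c → eq c d * f c) ≈ x d * f d
  ∫-eq f d = trans (∫-cong (λ c → eq-subst f c d)) (∫-*ʳ (λ c → eq c d) (f d))

  -- Elementary symmetric functions

  -- J n k is e_n in the variables x_k, x_{k+1}, …, and E n k d is the same with x_d left out.
  J : ℕ → ℕ → Carrier
  J zero    k = 1#
  J (suc n) k = ∫ (λ c → le k c * J n (suc c))

  E : ℕ → ℕ → ℕ → Carrier
  E zero    k d = 1#
  -- Coefficients of E(t) (1 + x_d t) = J(t) are compared. This leaves out x_d only for `k ≤ d`,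
  -- where `J` contains that variable.
  E (suc n) k d = J (suc n) k - x d * E n k d

  private
    -- The cases a < c, a = c and a > c; in the last two, `k ≤ c` already gives `k ≤ a`.
    le-split : ∀ {k c} → k ℕ.≤ c → ∀ a →
      le k a ≈ le k a * le (suc a) c + eq a c + le (suc c) a
    le-split {k} {c} k≤c a with ℕₚ.<-cmp a c
    ... | tri< a<c a≢c _ = sym (begin
      le k a * le (suc a) c + eq a c + le (suc c) a
        ≈⟨ +-cong (+-cong (*-congˡ (le-yes a<c)) (eq-no a≢c)) (le-no (ℕₚ.m<n⇒m<1+n a<c)) ⟩
      le k a * 1# + 0# + 0# ≈⟨ lem (le k a) ⟩
      le k a ∎)
      where
      lem = solve 1 (λ z → z :* con 1ᶜ :+ con 0ᶜ :+ con 0ᶜ := z) refl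
    ... | tri≈ _ ≡.refl _ = sym (begin
      le k a * le (suc a) a + eq a a + le (suc a) a
        ≈⟨ +-cong (+-cong (*-congˡ (le-no {suc a} {a} (ℕₚ.n<1+n a))) (eq-yes {a} ≡.refl))
             (le-no {suc a} {a} (ℕₚ.n<1+n a)) ⟩
      le k a * 0# + 1# + 0# ≈⟨ lem (le k a) ⟩
      1#                    ≈⟨ le-yes k≤c ⟨
      le k a ∎)
      where
      lem = solve 1 (λ z → z :* con 0ᶜ :+ con 1ᶜ :+ con 0ᶜ := con 1ᶜ) refl
    ... | tri> _ a≢c c<a = sym (begin
      le k a * le (suc a) c + eq a c + le (suc c) a
        ≈⟨ +-cong (+-cong (*-congˡ (le-no (ℕₚ.m<n⇒m<1+n c<a))) (eq-no a≢c)) (le-yes c<a) ⟩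
      le k a * 0# + 0# + 1# ≈⟨ lem (le k a) ⟩
      1#                    ≈⟨ le-yes (ℕₚ.≤-trans k≤c (ℕₚ.<⇒≤ c<a)) ⟨
      le k a ∎)
      where
      lem = solve 1 (λ z → z :* con 0ᶜ :+ con 0ᶜ :+ con 1ᶜ := con 1ᶜ) refl

    J-split : ∀ {k c} → k ℕ.≤ c → ∀ n → J (suc n) k ≈
      ∫ (λ a → le k a * (le (suc a) c * J n (suc a))) + x c * J n (suc c) + J (suc n) (suc c)
    J-split {k} {c} k≤c n = begin
      ∫ (λ a → le k a * J n (suc a))
        ≈⟨ ∫-cong (λ a → trans (*-congʳ (le-split k≤c a)) (lem _ _ _ _ _)) ⟩
      ∫ (λ a → le k a * (le (suc a) c * J n (suc a)) + eq a c * J n (suc a) + le (suc c) a * J n (suc a))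
        ≈⟨ ∫-+ _ _ ⟩
      ∫ (λ a → le k a * (le (suc a) c * J n (suc a)) + eq a c * J n (suc a)) + J (suc n) (suc c)
        ≈⟨ +-congʳ (∫-+ _ _) ⟩
      ∫ (λ a → le k a * (le (suc a) c * J n (suc a))) + ∫ (λ a → eq a c * J n (suc a)) + J (suc n) (suc c)
        ≈⟨ +-congʳ (+-congˡ (∫-eq (λ a → J n (suc a)) c)) ⟩
      ∫ (λ a → le k a * (le (suc a) c * J n (suc a))) + x c * J n (suc c) + J (suc n) (suc c) ∎
      where
      lem = solve 5 (λ p q r s t →
        (p :* q :+ r :+ s) :* t :=
        p :* (q :* t) :+ r :* t :+ s :* t) refl

  -- The smallest letter a of a set avoiding c is either below c or not.
  E-split : ∀ n {k c} → k ℕ.≤ c →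
    E (suc n) k c ≈ ∫ (λ a → le k a * (le (suc a) c * E n (suc a) c)) + J (suc n) (suc c)
  E-split zero {k} {c} k≤c = begin
    J 1 k - x c * 1#                 ≈⟨ +-congʳ (J-split k≤c 0) ⟩
    _ + x c * 1# + J 1 (suc c) - x c * 1# ≈⟨ lem _ _ _ ⟩
    ∫ (λ a → le k a * (le (suc a) c * 1#)) + J 1 (suc c) ∎
    where
    lem = solve 3 (λ p q r → p :+ q :+ r :- q := p :+ r) refl
  E-split (suc n) {k} {c} k≤c = begin
    J (suc (suc n)) k - x c * E (suc n) k c
      ≈⟨ +-cong (J-split k≤c (suc n)) (-‿cong (*-congˡ (E-split n k≤c))) ⟩
    ∫ f + x c * J (suc n) (suc c) + J (suc (suc n)) (suc c) - x c * (∫ g + J (suc n) (suc c))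
      ≈⟨ lem _ _ _ _ _ ⟩
    ∫ f + (- x c) * ∫ g + J (suc (suc n)) (suc c)
      ≈⟨ +-congʳ (+-congˡ (*-∫ _ _)) ⟩
    ∫ f + ∫ (λ a → (- x c) * g a) + J (suc (suc n)) (suc c)
      ≈⟨ +-congʳ (∫-+ _ _) ⟨
    ∫ (λ a → f a + (- x c) * g a) + J (suc (suc n)) (suc c)
      ≈⟨ +-congʳ (∫-cong (λ a → lem′ _ _ _ _ _)) ⟩
    ∫ (λ a → le k a * (le (suc a) c * E (suc n) (suc a) c)) + J (suc (suc n)) (suc c) ∎
    where
    f g : ℕ → Carrier
    f a = le k a * (le (suc a) c * J (suc n) (suc a))
    g a = le k a * (le (suc a) c * E n (suc a) c)
    lem = solve 5 (λ p q r s t → p :+ q :* r :+ s :- q :* (t :+ r) := p :+ (:- q) :* t :+ s) refl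
    lem′ = solve 5 (λ p q r s t →
      p :* (q :* r) :+ (:- s) :* (p :* (q :* t)) :=
      p :* (q :* (r :- s :* t))) refl

  private
    -- The chain k ≤ a < c on the right already forces k ≤ c.
    le-absorb : ∀ k a c → le k c * (le k a * le (suc a) c) ≈ le k a * le (suc a) c
    le-absorb k a c with k ≤? a | suc a ≤? c
    ... | yes k≤a | yes a<c = trans (*-congʳ (le-yes (ℕₚ.≤-trans k≤a (ℕₚ.<⇒≤ a<c)))) (*-identityˡ _)
    ... | no  k≰a | _ = begin
      le k c * (le k a * le (suc a) c) ≈⟨ *-congˡ (*-congʳ (le-no (ℕₚ.≰⇒> k≰a))) ⟩
      le k c * (0# * le (suc a) c)     ≈⟨ lem _ _ ⟩
      0# * le (suc a) c                ≈⟨ *-congʳ (le-no (ℕₚ.≰⇒> k≰a)) ⟨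
      le k a * le (suc a) c ∎
      where
      lem = solve 2 (λ p q → p :* (con 0ᶜ :* q) := con 0ᶜ :* q) refl
    ... | yes _ | no a≮c = begin
      le k c * (le k a * le (suc a) c) ≈⟨ *-congˡ (*-congˡ (le-no (ℕₚ.≰⇒> a≮c))) ⟩
      le k c * (le k a * 0#)           ≈⟨ lem _ _ ⟩
      le k a * 0#                      ≈⟨ *-congˡ (le-no (ℕₚ.≰⇒> a≮c)) ⟨
      le k a * le (suc a) c ∎
      where
      lem = solve 2 (λ p q → p :* (q :* con 0ᶜ) := q :* con 0ᶜ) refl

    -- Lets a lemma with the hypothesis `k ≤ c`, such as `E-split`, be applied under an integral
    -- over all `c`.
    le-*-cong : ∀ {k c p q} → (k ℕ.≤ c → p ≈ q) → le k c * p ≈ le k c * q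
    le-*-cong {k} {c} h with k ≤? c
    ... | yes k≤c = *-congˡ (h k≤c)
    ... | no  k≰c = trans (*-congʳ (le-no (ℕₚ.≰⇒> k≰c)))
                   (trans (trans (zeroˡ _) (sym (zeroˡ _))) (sym (*-congʳ (le-no (ℕₚ.≰⇒> k≰c)))))

    -- Double counting: a set of n + 1 letters arises once for each choice of its member `c`. The
    -- induction looks at the smallest letter: if it is `c`, the others contribute `J`; otherwise it
    -- is some `a` below `c`, and the induction hypothesis applies to the letters above `a`.
    ∫-E-from : ∀ n k → ∫ (λ c → le k c * E n k c) ≈ # suc n * J (suc n) k
    ∫-E-from zero    k = lem _
      where
      lem = solve 1 (λ p → p := (con 1ᶜ :+ con 0ᶜ) :* p) refl
    ∫-E-from (suc n) k = begin
      ∫ (λ c → le k c * E (suc n) k c)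
        ≈⟨ ∫-cong (λ c → trans (le-*-cong (E-split n)) (distribˡ _ _ _)) ⟩
      ∫ (λ c → le k c * ∫ (g c) + le k c * J (suc n) (suc c))
        ≈⟨ ∫-+ _ _ ⟩
      ∫ (λ c → le k c * ∫ (g c)) + J (suc (suc n)) k
        ≈⟨ +-congʳ (∫-cong (λ c → *-∫ _ _)) ⟩
      ∫ (λ c → ∫ (λ a → le k c * g c a)) + J (suc (suc n)) k
        ≈⟨ +-congʳ (∫-cong (λ c → ∫-cong (λ a → trans (lem₁ _ _ _ _)
             (trans (*-congʳ (le-absorb k a c)) (*-assoc _ _ _))))) ⟩
      ∫ (λ c → ∫ (λ a → le k a * (le (suc a) c * E n (suc a) c))) + J (suc (suc n)) k
        ≈⟨ +-congʳ (∫-swap _) ⟩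
      ∫ (λ a → ∫ (λ c → le k a * (le (suc a) c * E n (suc a) c))) + J (suc (suc n)) k
        ≈⟨ +-congʳ (∫-cong (λ a → trans (∫-*ˡ _ _) (trans (*-congˡ (∫-E-from n (suc a))) (lem₂ _ _ _)))) ⟩
      ∫ (λ a → # suc n * (le k a * J (suc n) (suc a))) + J (suc (suc n)) k
        ≈⟨ +-congʳ (∫-*ˡ _ _) ⟩
      # suc n * J (suc (suc n)) k + J (suc (suc n)) k
        ≈⟨ lem₃ _ _ ⟩
      # suc (suc n) * J (suc (suc n)) k ∎
      where
      g : ℕ → ℕ → Carrier
      g c a = le k a * (le (suc a) c * E n (suc a) c)
      lem₁ = solve 4 (λ p q r s → p :* (q :* (r :* s)) := p :* (q :* r) :* s) refl
      lem₂ = solve 3 (λ p q r → p :* (q :* r) := q :* (p :* r)) refl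
      lem₃ = solve 2 (λ p q → p :* q :+ q := (con 1ᶜ :+ p) :* q) refl

  es : ℕ → Carrier
  es n = J n 0

  Eʳ : ℕ → ℕ → Carrier
  Eʳ n d = E n 0 d

  ∫-E : ∀ n → ∫ (Eʳ n) ≈ # suc n * es (suc n)
  ∫-E n = trans (∫-cong (λ c → sym (trans (*-congʳ (le-yes {0} {c} ℕ.z≤n)) (*-identityˡ _)))) (∫-E-from n 0)

  -- Walks

  A : (ℕ → Carrier) → ℕ → Carrier
  A f r = ∫ (λ s → neq r s * f s)

  A-cong : ∀ {f g} → (∀ r → f r ≈ g r) → ∀ r → A f r ≈ A g r
  A-cong f≈g r = ∫-cong (λ s → *-congˡ (f≈g s))

  infixr 9 A^_
  A^_ : ℕ → (ℕ → Carrier) → ℕ → Carrier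
  (A^ zero) f  = f
  (A^ suc k) f = A ((A^ k) f)

  A^-cong : ∀ k {f g} → (∀ r → f r ≈ g r) → ∀ r → (A^ k) f r ≈ (A^ k) g r
  A^-cong zero    f≈g = f≈g
  A^-cong (suc k) f≈g = A-cong (A^-cong k f≈g)

  A^-suc : ∀ k f r → (A^ suc k) f r ≈ (A^ k) (A f) r
  A^-suc zero    f r = refl
  A^-suc (suc k) f r = A-cong (A^-suc k f) r

  A^-+-* : ∀ k a f g r → (A^ k) (λ s → f s + a * g s) r ≈ (A^ k) f r + a * (A^ k) g r
  A^-+-* zero    a f g r = refl
  A^-+-* (suc k) a f g r = begin
    A ((A^ k) (λ s → f s + a * g s)) r ≈⟨ A-cong (A^-+-* k a f g) r ⟩
    ∫ (λ s → neq r s * ((A^ k) f s + a * (A^ k) g s)) ≈⟨ ∫-cong (λ s → lem _ _ _ _) ⟩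
    ∫ (λ s → neq r s * (A^ k) f s + a * (neq r s * (A^ k) g s)) ≈⟨ ∫-+ _ _ ⟩
    A ((A^ k) f) r + ∫ (λ s → a * (neq r s * (A^ k) g s)) ≈⟨ +-congˡ (∫-*ˡ _ _) ⟩
    A ((A^ k) f) r + a * A ((A^ k) g) r ∎
    where
    lem = solve 4 (λ p q r s → p :* (q :+ r :* s) := p :* q :+ r :* (p :* s)) refl

  -- The kernel `neq` is symmetric, and `∫-swap` exchanges its two ends.
  A-selfAdjoint : ∀ f g → ∫ (λ r → f r * A g r) ≈ ∫ (λ r → A f r * g r)
  A-selfAdjoint f g = begin
    ∫ (λ r → f r * A g r) ≈⟨ ∫-cong (λ r → *-∫ _ _) ⟩
    ∫ (λ r → ∫ (λ s → f r * (neq r s * g s))) ≈⟨ ∫-swap _ ⟩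
    ∫ (λ s → ∫ (λ r → f r * (neq r s * g s)))
      ≈⟨ ∫-cong (λ s → ∫-cong (λ r → trans (*-congˡ (*-congʳ (neq-sym r s))) (lem _ _ _))) ⟩
    ∫ (λ s → ∫ (λ r → neq s r * f r * g s)) ≈⟨ ∫-cong (λ s → ∫-*ʳ _ _) ⟩
    ∫ (λ r → A f r * g r) ∎
    where
    lem = solve 3 (λ p q r → p :* (q :* r) := q :* p :* r) refl

  A^-selfAdjoint : ∀ k f g → ∫ (λ r → f r * (A^ k) g r) ≈ ∫ (λ r → (A^ k) f r * g r)
  A^-selfAdjoint zero    f g = refl
  A^-selfAdjoint (suc k) f g = begin
    ∫ (λ r → f r * A ((A^ k) g) r)   ≈⟨ A-selfAdjoint f ((A^ k) g) ⟩
    ∫ (λ r → A f r * (A^ k) g r)     ≈⟨ A^-selfAdjoint k (A f) g ⟩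
    ∫ (λ r → (A^ k) (A f) r * g r)   ≈⟨ ∫-cong (λ r → *-congʳ (A^-suc k f r)) ⟨
    ∫ (λ r → (A^ suc k) f r * g r)   ∎

  L : ℕ → ℕ → Carrier
  L k = (A^ k) (λ _ → 1#)

  M : ℕ → ℕ → ℕ → Carrier
  M j r d = (A^ j) (λ s → neq s d) r

  -- A walk with j inner vertices has j + 1 steps, so `M j` is the kernel of `A^ suc j`.
  A^-kernel : ∀ j f r → (A^ suc j) f r ≈ ∫ (λ d → M j r d * f d)
  A^-kernel zero    f r = refl
  A^-kernel (suc j) f r = begin
    ∫ (λ s → neq r s * (A^ suc j) f s)
      ≈⟨ ∫-cong (λ s → trans (*-congˡ (A^-kernel j f s)) (*-∫ _ _)) ⟩
    ∫ (λ s → ∫ (λ d → neq r s * (M j s d * f d))) ≈⟨ ∫-swap _ ⟩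
    ∫ (λ d → ∫ (λ s → neq r s * (M j s d * f d)))
      ≈⟨ ∫-cong (λ d → trans (∫-cong (λ s → sym (*-assoc _ _ _))) (∫-*ʳ _ _)) ⟩
    ∫ (λ d → M (suc j) r d * f d) ∎

  M-suc : ∀ j r d → M (suc j) r d ≈ ∫ (λ s → M j r s * neq s d)
  M-suc j r d = A^-kernel j (λ s → neq s d) r

  -- Excluding the colour `r` from `∫-E` costs x_r E_n(r), the same amount by which E_{n+1}(r) falls
  -- short of e_{n+1}. The factor `1#` is kept so that `A^-+-*` can iterate the constant term into
  -- `L`.
  A-E : ∀ n r → A (Eʳ n) r ≈ Eʳ (suc n) r + (# n * es (suc n)) * 1#
  A-E n r = begin
    ∫ (λ c → neq r c * Eʳ n c) ≈⟨ lem₁ _ _ ⟩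
    (∫ (λ c → neq r c * Eʳ n c) + x r * Eʳ n r) - x r * Eʳ n r ≈⟨ +-congʳ sum ⟩
    # suc n * es (suc n) - x r * Eʳ n r ≈⟨ lem₂ _ _ _ ⟩
    es (suc n) - x r * Eʳ n r + (# n * es (suc n)) * 1# ∎
    where
    sum : ∫ (λ c → neq r c * Eʳ n c) + x r * Eʳ n r ≈ # suc n * es (suc n)
    sum = begin
      ∫ (λ c → neq r c * Eʳ n c) + x r * Eʳ n r
        ≈⟨ +-cong (∫-cong (λ c → *-congʳ (neq-sym r c))) (sym (∫-eq (Eʳ n) r)) ⟩
      ∫ (λ c → neq c r * Eʳ n c) + ∫ (λ c → eq c r * Eʳ n c) ≈⟨ ∫-+ _ _ ⟨
      ∫ (λ c → neq c r * Eʳ n c + eq c r * Eʳ n c)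
        ≈⟨ ∫-cong (λ c → trans (sym (distribʳ _ _ _)) (trans (*-congʳ (neq+eq c r)) (*-identityˡ _))) ⟩
      ∫ (Eʳ n) ≈⟨ ∫-E n ⟩
      # suc n * es (suc n) ∎
    lem₁ = solve 2 (λ p q → p := p :+ q :- q) refl
    lem₂ = solve 3 (λ p q r → (con 1ᶜ :+ p) :* q :- r := q :- r :+ (p :* q) :* con 1ᶜ) refl

  -- G i Z k = Σ_{t<k} (i + t) e_{i+t+1} Z_{k-1-t}
  G : ℕ → (ℕ → Carrier) → ℕ → Carrier
  G i Z zero    = 0#
  G i Z (suc k) = # i * es (suc i) * Z k + G (suc i) Z k

  G-cong : ∀ i {Z W} k → (∀ j → Z j ≈ W j) → G i Z k ≈ G i W k
  G-cong i zero    h = refl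
  G-cong i (suc k) h = +-cong (*-congˡ (h k)) (G-cong (suc i) k h)

  G-+ : ∀ i Z W k → G i (λ j → Z j + W j) k ≈ G i Z k + G i W k
  G-+ i Z W zero    = sym (+-identityˡ 0#)
  G-+ i Z W (suc k) = trans (+-congˡ (G-+ (suc i) Z W k)) (lem _ _ _ _ _)
    where
    lem = solve 5 (λ e z w g h → e :* (z :+ w) :+ (g :+ h) := (e :* z :+ g) :+ (e :* w :+ h)) refl

  G-* : ∀ i Z b k → G i (λ j → Z j * b) k ≈ G i Z k * b
  G-* i Z b zero    = sym (zeroˡ b)
  G-* i Z b (suc k) = trans (+-congˡ (G-* (suc i) Z b k)) (lem _ _ _ _)
    where
    lem = solve 4 (λ e z b g → e :* (z :* b) :+ g :* b := (e :* z :+ g) :* b) refl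

  G-∫ : ∀ i (Z : ℕ → ℕ → Carrier) (f : ℕ → Carrier) k →
    ∫ (λ r → f r * G i (λ j → Z j r) k) ≈ G i (λ j → ∫ (λ r → f r * Z j r)) k
  G-∫ i Z f zero    = trans (∫-cong (λ r → zeroʳ (f r))) ∫-0
  G-∫ i Z f (suc k) = begin
    ∫ (λ r → f r * (u * Z k r + G (suc i) (λ j → Z j r) k)) ≈⟨ ∫-cong (λ r → lem _ _ _ _) ⟩
    ∫ (λ r → u * (f r * Z k r) + f r * G (suc i) (λ j → Z j r) k) ≈⟨ ∫-+ _ _ ⟩
    ∫ (λ r → u * (f r * Z k r)) + ∫ (λ r → f r * G (suc i) (λ j → Z j r) k)
      ≈⟨ +-cong (∫-*ˡ u _) (G-∫ (suc i) Z f k) ⟩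
    u * ∫ (λ r → f r * Z k r) + G (suc i) (λ j → ∫ (λ r → f r * Z j r)) k ∎
    where
    u = # i * es (suc i)
    lem = solve 4 (λ f u z g → f :* (u :* z :+ g) := u :* (f :* z) :+ f :* g) refl

  G-last : ∀ i Z k → G i Z (suc k) ≈
    G i (λ j → Z (suc j)) k + # (i ℕ.+ k) * es (suc (i ℕ.+ k)) * Z 0
  G-last i Z zero rewrite ℕₚ.+-identityʳ i = +-comm _ _
  G-last i Z (suc k) rewrite ℕₚ.+-suc i k =
    trans (+-congˡ (G-last (suc i) Z k)) (sym (+-assoc _ _ _))

  -- Each application of `A` raises the index of E by one and emits a constant; the applications
  -- still to come turn that constant into a multiple of some `L`.
  A^-E : ∀ k i r → (A^ k) (Eʳ i) r ≈ G i (λ j → L j r) k + Eʳ (i ℕ.+ k) r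
  A^-E zero    i r rewrite ℕₚ.+-identityʳ i = sym (+-identityˡ _)
  A^-E (suc k) i r rewrite ℕₚ.+-suc i k = begin
    (A^ suc k) (Eʳ i) r ≈⟨ A^-suc k (Eʳ i) r ⟩
    (A^ k) (A (Eʳ i)) r ≈⟨ A^-cong k (A-E i) r ⟩
    (A^ k) (λ s → Eʳ (suc i) s + # i * es (suc i) * 1#) r
      ≈⟨ A^-+-* k (# i * es (suc i)) (Eʳ (suc i)) (λ _ → 1#) r ⟩
    (A^ k) (Eʳ (suc i)) r + # i * es (suc i) * L k r ≈⟨ +-congʳ (A^-E k (suc i) r) ⟩
    G (suc i) (λ j → L j r) k + Eʳ (suc (i ℕ.+ k)) r + # i * es (suc i) * L k r ≈⟨ lem _ _ _ ⟩
    # i * es (suc i) * L k r + G (suc i) (λ j → L j r) k + Eʳ (suc (i ℕ.+ k)) r ∎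
    where
    lem = solve 3 (λ p q r → p :+ q :+ r := r :+ p :+ q) refl

  -- P k is the path on k + 1 vertices.
  P : ℕ → Carrier
  P k = ∫ (L k)

  -- By self-adjointness the integral of `Eʳ i` times `L k` equals that of `(A^ k) (Eʳ i)`, and this
  -- is the expansion of the latter by `A^-E` and `∫-E`. As a definition it makes the recursion in
  -- `i` and `k` purely formal.
  B : ℕ → ℕ → Carrier
  B i k = G i P k + # suc (i ℕ.+ k) * es (suc (i ℕ.+ k))

  B-suc : ∀ i k → B i (suc k) ≈ B (suc i) k + # i * es (suc i) * P k
  B-suc i k rewrite ℕₚ.+-suc i k = lem _ _ _
    where
    lem = solve 3 (λ p q r → p :+ q :+ r := q :+ r :+ p) refl

  B-+ : ∀ j i k → B i (j ℕ.+ k) ≈ G i (λ t → P (t ℕ.+ k)) j + B (i ℕ.+ j) k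
  B-+ zero    i k rewrite ℕₚ.+-identityʳ i = sym (+-identityˡ _)
  B-+ (suc j) i k = begin
    B i (suc (j ℕ.+ k)) ≈⟨ B-suc i (j ℕ.+ k) ⟩
    B (suc i) (j ℕ.+ k) + u ≈⟨ +-congʳ (B-+ j (suc i) k) ⟩
    G (suc i) (λ t → P (t ℕ.+ k)) j + B (suc i ℕ.+ j) k + u
      ≡⟨ ≡.cong (λ t → G (suc i) (λ t → P (t ℕ.+ k)) j + B t k + u) (≡.sym (ℕₚ.+-suc i j)) ⟩
    G (suc i) (λ t → P (t ℕ.+ k)) j + B (i ℕ.+ suc j) k + u ≈⟨ lem _ _ _ ⟩
    u + G (suc i) (λ t → P (t ℕ.+ k)) j + B (i ℕ.+ suc j) k ∎
    where
    u = # i * es (suc i) * P (j ℕ.+ k)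
    lem = solve 3 (λ p q r → p :+ q :+ r := r :+ p :+ q) refl

  P≈B : ∀ k → P k ≈ B 0 k
  P≈B k = begin
    -- The constant `1#` is `Eʳ 0`.
    ∫ ((A^ k) (λ _ → 1#)) ≈⟨ ∫-cong (A^-E k 0) ⟩
    ∫ (λ r → G 0 (λ j → L j r) k + Eʳ k r) ≈⟨ ∫-+ _ _ ⟩
    ∫ (λ r → G 0 (λ j → L j r) k) + ∫ (Eʳ k) ≈⟨ +-cong
      (trans (∫-cong (λ r → sym (*-identityˡ _))) (trans (G-∫ 0 L (λ _ → 1#) k)
        (G-cong 0 k (λ j → ∫-cong (λ r → *-identityˡ _))))) (∫-E k) ⟩
    B 0 k ∎

  -- T j l is the cycle on j + 1 vertices with a path of l further vertices attached to it.
  T : ℕ → ℕ → Carrier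
  T j l = ∫ (λ r → M j r r * L l r)

  C : ℕ → Carrier
  C j = ∫ (λ r → M j r r)

  T-0 : ∀ j → T j 0 ≈ C j
  T-0 j = ∫-cong (λ r → *-identityʳ _)

  T-loop : ∀ l → T 0 l ≈ 0#
  T-loop l = trans (∫-cong (λ r → trans (*-congʳ (neq-no {r} ≡.refl)) (zeroˡ _))) ∫-0

  private
    ∫∫-split : ∀ (f : ℕ → ℕ → Carrier) → ∫ (λ r → ∫ (f r)) ≈
      ∫ (λ r → ∫ (λ c → neq r c * f r c)) + ∫ (λ r → ∫ (λ c → eq r c * f r c))
    ∫∫-split f = begin
      ∫ (λ r → ∫ (f r)) ≈⟨ ∫-cong (λ r → ∫-cong (λ c → sym
        (trans (sym (distribʳ _ _ _)) (trans (*-congʳ (neq+eq r c)) (*-identityˡ _))))) ⟩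
      ∫ (λ r → ∫ (λ c → neq r c * f r c + eq r c * f r c)) ≈⟨ ∫-cong (λ r → ∫-+ _ _) ⟩
      ∫ (λ r → ∫ (λ c → neq r c * f r c) + ∫ (λ c → eq r c * f r c)) ≈⟨ ∫-+ _ _ ⟩
      _ ∎

    ∫∫-* : ∀ f g → ∫ (λ r → ∫ (λ c → f r * g c)) ≈ ∫ f * ∫ g
    ∫∫-* f g = trans (∫-cong (λ r → ∫-*ˡ _ _)) (∫-*ʳ _ _)

  -- Either side counts the colourings of a path on j + l + 2 vertices and of a disjoint
  -- cycle and path, according to whether two of the colours agree; where they agree, the
  -- two graphs have the same colourings.
  C*P : ∀ j l → C j * P l + T (suc j) l ≈ T j (suc l) + P (j ℕ.+ suc l)
  C*P j l = begin
    C j * P l + T (suc j) l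
      ≈⟨ +-congʳ (trans (sym (∫∫-* _ _)) (∫∫-split _)) ⟩
    ∫ (λ r → ∫ (λ c → neq r c * (M j r r * L l c))) + ∫ (λ r → ∫ (λ c → eq r c * (M j r r * L l c))) + T (suc j) l
      ≈⟨ +-congʳ (+-cong
           (∫-cong (λ r → trans (∫-cong (λ c → lem₁ _ _ _)) (∫-*ˡ _ _)))
           (∫-cong (λ r → ∫-cong (λ c → trans (sym (*-assoc _ _ _))
             (trans (*-congʳ (eq-subst (M j r) r c)) (*-assoc _ _ _)))))) ⟩
    T j (suc l) + ∫ (λ r → ∫ (λ c → eq r c * (M j r c * L l c))) + T (suc j) l
      ≈⟨ lem₂ _ _ _ ⟩
    T j (suc l) + (T (suc j) l + ∫ (λ r → ∫ (λ c → eq r c * (M j r c * L l c))))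
      ≈⟨ +-congˡ (+-congʳ T-suc) ⟩
    T j (suc l) + (∫ (λ r → ∫ (λ c → neq r c * (M j r c * L l c))) + ∫ (λ r → ∫ (λ c → eq r c * (M j r c * L l c))))
      ≈⟨ +-congˡ (∫∫-split _) ⟨
    T j (suc l) + ∫ (λ r → ∫ (λ c → M j r c * L l c))
      ≈⟨ +-congˡ (∫-cong (λ r → trans (sym (A^-kernel j (L l) r)) (A^-L (suc j) r))) ⟩
    T j (suc l) + P (suc j ℕ.+ l) ≡⟨ ≡.cong (λ t → T j (suc l) + P t) (≡.sym (ℕₚ.+-suc j l)) ⟩
    T j (suc l) + P (j ℕ.+ suc l) ∎
    where
    lem₁ = solve 3 (λ p q r → p :* (q :* r) := q :* (p :* r)) refl
    lem₂ = solve 3 (λ p q r → p :+ q :+ r := p :+ (r :+ q)) refl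
    A^-L : ∀ i r → (A^ i) (L l) r ≈ L (i ℕ.+ l) r
    A^-L zero    r = refl
    A^-L (suc i) r = A-cong (A^-L i) r
    T-suc : T (suc j) l ≈ ∫ (λ r → ∫ (λ c → neq r c * (M j r c * L l c)))
    T-suc = begin
      ∫ (λ c → ∫ (λ r → neq c r * M j r c) * L l c) ≈⟨ ∫-cong (λ c → ∫-*ʳ _ _) ⟨
      ∫ (λ c → ∫ (λ r → neq c r * M j r c * L l c)) ≈⟨ ∫-swap _ ⟩
      ∫ (λ r → ∫ (λ c → neq c r * M j r c * L l c))
        ≈⟨ ∫-cong (λ r → ∫-cong (λ c → trans (*-assoc _ _ _) (*-congʳ (neq-sym c r)))) ⟩
      ∫ (λ r → ∫ (λ c → neq r c * (M j r c * L l c))) ∎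

  -- An implication, so that the induction for `T-recurrence` can feed it its own hypothesis at
  -- `l = 0`, the cycle with no path attached.
  C-from-T : ∀ j → T j 0 ≈ G 0 (λ i → T i 0) j + # j * B j 0 →
    C j ≈ G 0 C j + # j * (# suc j * es (suc j))
  C-from-T j T-rec = begin
    C j ≈⟨ T-0 j ⟨
    T j 0 ≈⟨ T-rec ⟩
    G 0 (λ i → T i 0) j + # j * B j 0 ≈⟨ +-cong (G-cong 0 j T-0) (*-congˡ (trans (+-identityˡ _)
      (reflexive (≡.cong (λ t → # suc t * es (suc t)) (ℕₚ.+-identityʳ j))))) ⟩
    G 0 C j + # j * (# suc j * es (suc j)) ∎

  T-recurrence : ∀ j l → T j l ≈ G 0 (λ i → T i l) j + # j * B j l
  T-recurrence zero    l = trans (T-loop l) (lem _)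
    where
    lem = solve 1 (λ p → con 0ᶜ := con 0ᶜ :+ con 0ᶜ :* p) refl
  T-recurrence (suc j) l = ∙-cancelˡ (C j * P l) _ _ (begin
    C j * P l + T (suc j) l ≈⟨ C*P j l ⟩
    T j (suc l) + P (j ℕ.+ suc l)
      ≈⟨ +-cong (T-recurrence j (suc l)) (trans (P≈B (j ℕ.+ suc l)) (B-+ j 0 (suc l))) ⟩
    gT + # j * B j (suc l) + (gP + B j (suc l))
      ≈⟨ +-cong (+-congˡ (*-congˡ (B-suc j l))) (+-congˡ (B-suc j l)) ⟩
    gT + # j * (b + # j * es (suc j) * P l) + (gP + (b + # j * es (suc j) * P l))
      ≈⟨ lem _ _ _ _ _ _ _ ⟩
    (gC + # j * (# suc j * es (suc j))) * P l + (gT + gP - gC * P l + # suc j * b)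
      ≈⟨ +-cong (*-congʳ (sym C-rec)) (+-congʳ (sym shift)) ⟩
    C j * P l + (G 0 (λ i → T i l) (suc j) + # suc j * b) ∎)
    where
    gT = G 0 (λ i → T i (suc l)) j
    gP = G 0 (λ i → P (i ℕ.+ suc l)) j
    gC = G 0 C j
    b = B (suc j) l
    lem = solve 7 (λ gT gP gC b j e p →
      gT :+ j :* (b :+ j :* e :* p) :+ (gP :+ (b :+ j :* e :* p)) :=
      (gC :+ j :* ((con 1ᶜ :+ j) :* e)) :* p :+ (gT :+ gP :- gC :* p :+ (con 1ᶜ :+ j) :* b)) refl
    C-rec = C-from-T j (T-recurrence j 0)
    shift : G 0 (λ i → T i l) (suc j) ≈ gT + gP - gC * P l
    shift = begin
      G 0 (λ i → T i l) (suc j) ≈⟨ G-last 0 (λ i → T i l) j ⟩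
      -- The last term of the sum belongs to a loop, which has no proper colouring.
      gS + # j * es (suc j) * T 0 l ≈⟨ +-congˡ (trans (*-congˡ (T-loop l)) (zeroʳ _)) ⟩
      gS + 0# ≈⟨ lem′ _ _ ⟩
      (gC * P l + gS) - gC * P l ≈⟨ +-congʳ (begin
        gC * P l + gS ≈⟨ +-congʳ (G-* 0 C (P l) j) ⟨
        G 0 (λ i → C i * P l) j + gS ≈⟨ G-+ 0 _ _ j ⟨
        G 0 (λ i → C i * P l + T (suc i) l) j ≈⟨ G-cong 0 j (λ i → C*P i l) ⟩
        G 0 (λ i → T i (suc l) + P (i ℕ.+ suc l)) j ≈⟨ G-+ 0 _ _ j ⟩
        gT + gP ∎) ⟩
      gT + gP - gC * P l ∎
      where
      gS = G 0 (λ i → T (suc i) l) j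
      lem′ = solve 2 (λ p q → p :+ con 0ᶜ := q :+ p :- q) refl

  C-recurrence : ∀ j → C j ≈ G 0 C j + # j * (# suc j * es (suc j))
  C-recurrence j = C-from-T j (T-recurrence j 0)

  -- Y j l is the line graph of a tadpole, on a cycle with j + 1 and a path with l + 1 vertices.
  Y : ℕ → ℕ → Carrier
  Y j l = T j (suc l) + T j (suc l) - C j * P l

  -- `B-suc` releases `# j * es (suc j) * P l` from each of the two tadpoles, and the inhomogeneous
  -- part of the subtracted `C j * P l` is charged against these terms.
  Y-recurrence : ∀ j l → Y j l ≈
    G 0 (λ i → Y i l) j + # j * (B (suc j) l + B (suc j) l + (# j * (es (suc j) * P l) - es (suc j) * P l))
  Y-recurrence j l = begin
    T j (suc l) + T j (suc l) - C j * P l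
      ≈⟨ +-cong (+-cong Tr Tr) (-‿cong (*-congʳ (C-recurrence j))) ⟩
    gT + # j * (b + # j * e * P l) + (gT + # j * (b + # j * e * P l)) - (G 0 C j + # j * (# suc j * e)) * P l
      ≈⟨ lem _ _ _ _ _ _ ⟩
    gT + gT + G 0 C j * - P l + # j * (b + b + (# j * (e * P l) - e * P l))
      ≈⟨ +-congʳ (+-cong (G-+ 0 _ _ j) (G-* 0 C (- P l) j)) ⟨
    G 0 (λ i → T i (suc l) + T i (suc l)) j + G 0 (λ i → C i * - P l) j + # j * (b + b + (# j * (e * P l) - e * P l))
      ≈⟨ +-congʳ (G-+ 0 _ _ j) ⟨
    G 0 (λ i → T i (suc l) + T i (suc l) + C i * - P l) j + # j * (b + b + (# j * (e * P l) - e * P l))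
      ≈⟨ +-congʳ (G-cong 0 j (λ i → lem′ _ _ _)) ⟩
    G 0 (λ i → Y i l) j + # j * (b + b + (# j * (e * P l) - e * P l)) ∎
    where
    e = es (suc j)
    b = B (suc j) l
    gT = G 0 (λ i → T i (suc l)) j
    Tr : T j (suc l) ≈ gT + # j * (b + # j * e * P l)
    Tr = trans (T-recurrence j (suc l)) (+-congˡ (*-congˡ (B-suc j l)))
    lem = solve 6 (λ t j b e p c →
      t :+ j :* (b :+ j :* e :* p) :+ (t :+ j :* (b :+ j :* e :* p)) :- (c :+ j :* ((con 1ᶜ :+ j) :* e)) :* p :=
      t :+ t :+ c :* (:- p) :+ j :* (b :+ b :+ (j :* (e :* p) :- e :* p))) refl
    lem′ = solve 3 (λ t c p → t :+ t :+ c :* (:- p) := t :+ t :- c :* p) refl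

  -- Positivity

  -- Products are formed with one generator at a time, so that a derivation can be read off as a
  -- list of partitions; the recurrences produce only such products.
  data EPos : Carrier → Set (c ⊔ ℓ) where
    1-pos  : EPos 1#
    0-pos  : EPos 0#
    +-pos  : ∀ {f g} → EPos f → EPos g → EPos (f + g)
    es-pos : ∀ i {f} → EPos f → EPos (es (suc i) * f)
    ≈-pos  : ∀ {f g} → f ≈ g → EPos f → EPos g

  #-pos : ∀ n {f} → EPos f → EPos (# n * f)
  #-pos zero    p = ≈-pos (sym (zeroˡ _)) 0-pos
  #-pos (suc n) p = ≈-pos (sym (trans (distribʳ _ _ _) (+-congʳ (*-identityˡ _)))) (+-pos p (#-pos n p))

  G-pos : ∀ i {Z} k → (∀ {j} → j ℕ.< k → EPos (Z j)) → EPos (G i Z k)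
  G-pos i zero    h = 0-pos
  G-pos i (suc k) h = +-pos
    (≈-pos (sym (*-assoc _ _ _)) (#-pos i (es-pos i (h (ℕₚ.n<1+n k)))))
    (G-pos (suc i) k (λ j<k → h (ℕₚ.m<n⇒m<1+n j<k)))

  -- Asks for positivity of `P` only below `k`, because it serves the strong induction that proves
  -- `P-pos`.
  B-pos-below : ∀ i k → (∀ {j} → j ℕ.< k → EPos (P j)) → EPos (B i k)
  B-pos-below i k h = +-pos (G-pos i k h)
    (#-pos (suc (i ℕ.+ k)) (≈-pos (*-identityʳ _) (es-pos (i ℕ.+ k) 1-pos)))

  P-pos : ∀ k → EPos (P k)
  P-pos = <-rec _ λ k rec → ≈-pos (sym (P≈B k)) (B-pos-below 0 k rec)

  B-pos : ∀ i k → EPos (B i k)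
  B-pos i k = B-pos-below i k (λ {j} _ → P-pos j)

  -- For j = 0, the only case in which the bracket may be negative, its factor # j vanishes.
  Y-pos : ∀ l j → EPos (Y j l)
  Y-pos l = <-rec _ λ j rec → ≈-pos (sym (Y-recurrence j l)) (+-pos (G-pos 0 j rec) (rest j))
    where
    rest : ∀ j → EPos (# j * (B (suc j) l + B (suc j) l + (# j * (es (suc j) * P l) - es (suc j) * P l)))
    rest zero    = ≈-pos (sym (zeroˡ _)) 0-pos
    rest (suc i) = #-pos (suc i) (+-pos (+-pos (B-pos _ l) (B-pos _ l))
      (≈-pos (lem _ _) (#-pos i (es-pos (suc i) (P-pos l)))))
      where
      lem = solve 2 (λ i p → i :* p := (con 1ᶜ :+ i) :* p :- p) refl

  -- Sums over words

  -- Every `∫` brings in the variable of its letter, so `F w` is weighted by the monomial of `w`.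
  S : ∀ n → (Vec ℕ n → Carrier) → Carrier
  S zero    F = F []
  S (suc n) F = ∫ (λ c → S n (λ w → F (c ∷ w)))

  S-cong : ∀ n {F F′} → (∀ w → F w ≈ F′ w) → S n F ≈ S n F′
  S-cong zero    h = h []
  S-cong (suc n) h = ∫-cong (λ c → S-cong n (λ w → h (c ∷ w)))

  S-*ˡ : ∀ n a F → S n (λ w → a * F w) ≈ a * S n F
  S-*ˡ zero    a F = refl
  S-*ˡ (suc n) a F = trans (∫-cong (λ c → S-*ˡ n a (λ w → F (c ∷ w)))) (∫-*ˡ a _)

  S-*ʳ : ∀ n a F → S n (λ w → F w * a) ≈ S n F * a
  S-*ʳ n a F = trans (S-cong n (λ w → *-comm (F w) a)) (trans (S-*ˡ n a F) (*-comm a _))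

  S-++ : ∀ m n F → S (m ℕ.+ n) F ≈ S m (λ x → S n (λ y → F (x ++ y)))
  S-++ zero    n F = refl
  S-++ (suc m) n F = ∫-cong (λ c → S-++ m n (λ w → F (c ∷ w)))

  private
    S-step : ∀ n r c (b : Vec ℕ n → Bool) (F : Vec ℕ n → Carrier) {z} → S n (λ w → ⟨ b w ⟩ * F w) ≈ z →
      S n (λ w → ⟨ not (does (r ≟ c)) ∧ b w ⟩ * F w) ≈ neq r c * z
    S-step n r c b F h = trans
      (trans (S-cong n (λ w → trans (*-congʳ (⟨∧⟩ _ (b w))) (*-assoc _ _ _))) (S-*ˡ n _ _)) (*-congˡ h)

  -- Serves the closing edge of a cycle, where `u` is the last vertex and `s` the colour of the
  -- first.
  S-walk-last : ∀ k (u : Fin (suc k)) → toℕ u ≡ k → ∀ (h : ℕ → Carrier) r s →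
    S k (λ w → ⟨ does (walk? r w s) ⟩ * h (lookup (r ∷ w) u)) ≈ (A^ k) (λ a → neq a s * h a) r
  S-walk-last zero    zero    _ h r s = refl
  S-walk-last (suc k) (suc u) p h r s =
    ∫-cong (λ c → S-step k r c _ _ (S-walk-last k u (ℕₚ.suc-injective p) h c s))

  S-walk : ∀ k r s → S k (λ w → ⟨ does (walk? r w s) ⟩ * 1#) ≈ M k r s
  S-walk zero    r s = *-identityʳ _
  S-walk (suc k) r s = ∫-cong (λ c → S-step k r c _ _ (S-walk k c s))

  S-link : ∀ k r → S k (λ w → ⟨ does (link? r w) ⟩ * 1#) ≈ L k r
  S-link zero    r = *-identityʳ _
  S-link (suc k) r = ∫-cong (λ c → S-step k r c _ _ (S-link k c))

  S-link-last : ∀ k (u : Fin (suc k)) → toℕ u ≡ k → ∀ (h : ℕ → Carrier) r →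
    S k (λ w → ⟨ does (link? r w) ⟩ * h (lookup (r ∷ w) u)) ≈ (A^ k) h r
  S-link-last zero    zero    _ h r = *-identityˡ _
  S-link-last (suc k) (suc u) p h r =
    ∫-cong (λ c → S-step k r c _ _ (S-link-last k u (ℕₚ.suc-injective p) h c))

  -- When `u` is the far end of the path, self-adjointness of `A` reverses the path.
  S-link-end : ∀ k (u : Fin (suc k)) → toℕ u ≡ 0 ⊎ suc (toℕ u) ≡ suc k → ∀ (h : ℕ → Carrier) →
    ∫ (λ r → S k (λ w → ⟨ does (link? r w) ⟩ * h (lookup (r ∷ w) u))) ≈ ∫ (λ r → L k r * h r)
  S-link-end k zero    (inj₁ _) h = ∫-cong (λ r → trans
    (trans (S-cong k (λ w → *-congʳ (sym (*-identityʳ _)))) (S-*ʳ k (h r) _)) (*-congʳ (S-link k r)))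
  S-link-end k u       (inj₂ p) h = begin
    ∫ (λ r → S k (λ w → ⟨ does (link? r w) ⟩ * h (lookup (r ∷ w) u)))
      ≈⟨ ∫-cong (λ r → S-link-last k u (ℕₚ.suc-injective p) h r) ⟩
    ∫ ((A^ k) h)                 ≈⟨ ∫-cong (λ r → *-identityˡ _) ⟨
    ∫ (λ r → 1# * (A^ k) h r)    ≈⟨ A^-selfAdjoint k (λ _ → 1#) h ⟩
    ∫ (λ r → L k r * h r)        ∎

  -- The walk is split at the edge from `u` to `v`: `p` steps lead from `r` to the colour `a` of
  -- `u`, and `i` inner vertices lie between the colour `b` of `v` and `s`.
  S-walk-step : ∀ p i (u v : Fin (suc (suc (p ℕ.+ i)))) → toℕ u ≡ p → toℕ v ≡ suc p → ∀ (g : ℕ → ℕ → Carrier) r s →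
    S (suc (p ℕ.+ i)) (λ w → ⟨ does (walk? r w s) ⟩ * g (lookup (r ∷ w) u) (lookup (r ∷ w) v)) ≈
    (A^ p) (λ a → ∫ (λ b → neq a b * (M i b s * g a b))) r
  S-walk-step zero    i zero    (suc zero) _ _ g r s = ∫-cong (λ c → S-step i r c _ _ (trans
    (trans (S-cong i (λ w → *-congʳ (sym (*-identityʳ _)))) (S-*ʳ i (g r c) _)) (*-congʳ (S-walk i c s))))
  S-walk-step (suc p) i (suc u) (suc v) h h′ g r s = ∫-cong (λ c → S-step (suc (p ℕ.+ i)) r c
    (λ w → does (walk? c w s)) (λ w → g (lookup (c ∷ w) u) (lookup (c ∷ w) v))
    (S-walk-step p i u v (ℕₚ.suc-injective h) (ℕₚ.suc-injective h′) g c s))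

  -- The meeting point `s` of the two walks becomes an inner vertex itself; hence the `suc`.
  M-comp : ∀ i p r d → ∫ (λ s → M i r s * M p s d) ≈ M (suc i ℕ.+ p) r d
  M-comp i p r d = trans (sym (A^-kernel i (λ s → M p s d) r)) (A^-+ (suc i) r)
    where
    A^-+ : ∀ i r → (A^ i) (λ s → M p s d) r ≈ M (i ℕ.+ p) r d
    A^-+ zero    r = refl
    A^-+ (suc i) r = A-cong (A^-+ i) r

  -- The cycle is rotated: cut at the edge `u v` rather than at its base vertex, the pieces from `b`
  -- to `r` and from `r` to `a` join into one walk from `b` to `a`. For `p = 0` the vertex `u` is
  -- the base vertex.
  S-cycle-step : ∀ p i (u v : Fin (suc (suc (p ℕ.+ i)))) → toℕ u ≡ p → toℕ v ≡ suc p →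
    ∀ (g : ℕ → ℕ → Carrier) →
    ∫ (λ r → S (suc (p ℕ.+ i)) (λ w → ⟨ does (walk? r w r) ⟩ * g (lookup (r ∷ w) u) (lookup (r ∷ w) v))) ≈
    ∫ (λ a → ∫ (λ b → neq a b * (M (p ℕ.+ i) b a * g a b)))
  S-cycle-step zero    i u v h h′ g = ∫-cong (λ r → S-walk-step 0 i u v h h′ g r r)
  S-cycle-step (suc p) i u v eq eq′ g = begin
    _ ≈⟨ ∫-cong (λ r → S-walk-step (suc p) i u v eq eq′ g r r) ⟩
    ∫ (λ r → (A^ suc p) (h r) r) ≈⟨ ∫-cong (λ r → A^-kernel p (h r) r) ⟩
    ∫ (λ r → ∫ (λ a → M p r a * ∫ (λ b → neq a b * (M i b r * g a b))))
      ≈⟨ ∫-swap (λ r a → M p r a * ∫ (λ b → neq a b * (M i b r * g a b))) ⟩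
    ∫ (λ a → ∫ (λ r → M p r a * ∫ (λ b → neq a b * (M i b r * g a b))))
      ≈⟨ ∫-cong (λ a → ∫-cong (λ r → *-∫ _ _)) ⟩
    ∫ (λ a → ∫ (λ r → ∫ (λ b → M p r a * (neq a b * (M i b r * g a b)))))
      ≈⟨ ∫-cong (λ a → ∫-swap (λ r b → M p r a * (neq a b * (M i b r * g a b)))) ⟩
    ∫ (λ a → ∫ (λ b → ∫ (λ r → M p r a * (neq a b * (M i b r * g a b)))))
      ≈⟨ ∫-cong (λ a → ∫-cong (λ b → begin
        ∫ (λ r → M p r a * (neq a b * (M i b r * g a b))) ≈⟨ ∫-cong (λ r → lem _ _ _ _) ⟩
        ∫ (λ r → M i b r * M p r a * (neq a b * g a b))   ≈⟨ ∫-*ʳ _ _ ⟩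
        ∫ (λ r → M i b r * M p r a) * (neq a b * g a b)   ≈⟨ *-congʳ (M-comp i p b a) ⟩
        M (suc i ℕ.+ p) b a * (neq a b * g a b)
          ≡⟨ ≡.cong (λ t → M (suc t) b a * (neq a b * g a b)) (ℕₚ.+-comm i p) ⟩
        M (suc p ℕ.+ i) b a * (neq a b * g a b)           ≈⟨ lem′ _ _ _ ⟩
        neq a b * (M (suc p ℕ.+ i) b a * g a b)           ∎)) ⟩
    ∫ (λ a → ∫ (λ b → neq a b * (M (suc p ℕ.+ i) b a * g a b))) ∎
    where
    h : ℕ → ℕ → Carrier
    h s a = ∫ (λ b → neq a b * (M i b s * g a b))
    lem = solve 4 (λ p q r s → p :* (q :* (r :* s)) := r :* p :* (q :* s)) refl
    lem′ = solve 3 (λ p q r → p :* (q :* r) := q :* (p :* r)) refl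

  S-cycle : ∀ j (u v : Fin (suc (suc j))) → ConsecutiveOnCycle u v → ∀ (g : ℕ → ℕ → Carrier) →
    ∫ (λ r → S (suc j) (λ w → ⟨ does (walk? r w r) ⟩ * g (lookup (r ∷ w) u) (lookup (r ∷ w) v))) ≈
    ∫ (λ a → ∫ (λ b → neq a b * (M j b a * g a b)))
  S-cycle j u zero (inj₂ (p , _)) g = begin
    _ ≈⟨ ∫-cong (λ r → S-walk-last (suc j) u (ℕₚ.suc-injective p) (λ a → g a r) r r) ⟩
    ∫ (λ r → (A^ suc j) (λ a → neq a r * g a r) r) ≈⟨ ∫-cong (λ r → A^-kernel j _ r) ⟩
    ∫ (λ r → ∫ (λ a → M j r a * (neq a r * g a r))) ≈⟨ ∫-swap (λ r a → M j r a * (neq a r * g a r)) ⟩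
    ∫ (λ a → ∫ (λ r → M j r a * (neq a r * g a r))) ≈⟨ ∫-cong (λ a → ∫-cong (λ r → lem _ _ _)) ⟩
    ∫ (λ a → ∫ (λ b → neq a b * (M j b a * g a b))) ∎
    where
    lem = solve 3 (λ p q r → p :* (q :* r) := q :* (p :* r)) refl
  -- As `v` follows `u`, `toℕ u ≤ j`; the difference is the index `i` of `S-cycle-step`.
  S-cycle j u v (inj₁ e) g = from (toℕ u) (ℕₚ.m≤n⇒∃[o]m+o≡n
    (ℕₚ.≤-pred (ℕₚ.≤-pred (ℕₚ.≤-trans (ℕₚ.≤-reflexive (≡.cong suc e)) (toℕ<n v))))) u v ≡.refl (≡.sym e)
    where
    from : ∀ {j} p → ∃[ i ] p ℕ.+ i ≡ j → (u v : Fin (suc (suc j))) → toℕ u ≡ p → toℕ v ≡ suc p →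
      ∫ (λ r → S (suc j) (λ w → ⟨ does (walk? r w r) ⟩ * g (lookup (r ∷ w) u) (lookup (r ∷ w) v))) ≈
      ∫ (λ a → ∫ (λ b → neq a b * (M j b a * g a b)))
    from p (i , ≡.refl) u v eq eq′ = S-cycle-step p i u v eq eq′ g

  -- Inclusion and exclusion at the triangle

  private
    -- Two distinct colours cannot both agree with c.
    neq-triangle : ∀ a b c → neq a b * (neq a c * neq b c) ≈ neq a b * (neq a c + neq b c - 1#)
    neq-triangle a b c with a ≟ b | a ≟ c | b ≟ c
    ... | yes a≡b | _ | _ = begin
      neq a b * (neq a c * neq b c)        ≈⟨ *-congʳ (neq-no a≡b) ⟩
      0# * (neq a c * neq b c)             ≈⟨ trans (zeroˡ _) (sym (zeroˡ _)) ⟩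
      0# * (neq a c + neq b c - 1#)        ≈⟨ *-congʳ (neq-no a≡b) ⟨
      neq a b * (neq a c + neq b c - 1#)   ∎
    ... | no a≢b | yes ≡.refl | _ = *-congˡ (begin
      neq a a * neq b a      ≈⟨ *-cong (neq-no {a} ≡.refl) (neq-yes (a≢b ∘ ≡.sym)) ⟩
      0# * 1#                ≈⟨ lem ⟩
      0# + 1# - 1#           ≈⟨ +-congʳ (+-cong (neq-no {a} ≡.refl) (neq-yes (a≢b ∘ ≡.sym))) ⟨
      neq a a + neq b a - 1# ∎)
      where
      lem = solve 0 (con 0ᶜ :* con 1ᶜ := con 0ᶜ :+ con 1ᶜ :- con 1ᶜ) refl
    ... | no a≢b | no a≢c | _ = *-congˡ (begin
      neq a c * neq b c      ≈⟨ *-congʳ (neq-yes a≢c) ⟩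
      1# * neq b c           ≈⟨ lem _ ⟩
      1# + neq b c - 1#      ≈⟨ +-congʳ (+-congʳ (neq-yes a≢c)) ⟨
      neq a c + neq b c - 1# ∎)
      where
      lem = solve 1 (λ p → con 1ᶜ :* p := con 1ᶜ :+ p :- con 1ᶜ) refl

    avoiding : ℕ → ℕ → ℕ → Carrier
    avoiding l a b = ∫ (λ c → L l c * (neq a c * neq b c))

    avoiding-comm : ∀ l a b → avoiding l a b ≈ avoiding l b a
    avoiding-comm l a b = ∫-cong (λ c → *-congˡ (*-comm _ _))

    neq-avoiding : ∀ l a b → neq a b * avoiding l a b ≈ neq a b * (L (suc l) a + L (suc l) b + - P l)
    neq-avoiding l a b = begin
      neq a b * ∫ (λ c → L l c * (neq a c * neq b c)) ≈⟨ *-∫ _ _ ⟩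
      ∫ (λ c → neq a b * (L l c * (neq a c * neq b c)))
        ≈⟨ ∫-cong (λ c → trans (lem _ _ _) (trans (*-congˡ (neq-triangle a b c)) (lem′ _ _ _ _))) ⟩
      ∫ (λ c → neq a b * (neq a c * L l c + neq b c * L l c + - 1# * L l c)) ≈⟨ ∫-*ˡ _ _ ⟩
      neq a b * ∫ (λ c → neq a c * L l c + neq b c * L l c + - 1# * L l c)
        ≈⟨ *-congˡ (trans (∫-+ _ _) (+-cong (∫-+ _ _) (∫-*ˡ _ _))) ⟩
      neq a b * (L (suc l) a + L (suc l) b + - 1# * P l) ≈⟨ *-congˡ (+-congˡ (lem″ _)) ⟩
      neq a b * (L (suc l) a + L (suc l) b + - P l) ∎
      where
      lem = solve 3 (λ p q r → p :* (q :* r) := q :* (p :* r)) refl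
      lem′ = solve 4 (λ l ab ac bc → l :* (ab :* (ac :+ bc :- con 1ᶜ)) :=
        ab :* (ac :* l :+ bc :* l :+ :- con 1ᶜ :* l)) refl
      lem″ = solve 1 (λ p → :- con 1ᶜ :* p := :- p) refl

  -- The edge `a b` and the walk `M j b a` close up to a cycle on j + 2 vertices. Of the three terms
  -- of `neq-avoiding`, the first two hang the path on `a` and on `b`, giving two equal tadpoles;
  -- the third leaves cycle and path disjoint.
  ∫∫-avoiding : ∀ j l →
    ∫ (λ a → ∫ (λ b → neq a b * (M j b a * avoiding l a b))) ≈ Y (suc j) l
  ∫∫-avoiding j l = begin
    ∫ (λ a → ∫ (λ b → neq a b * (M j b a * avoiding l a b)))
      ≈⟨ ∫-cong (λ a → ∫-cong (λ b → trans (lem _ _ _) (trans (*-congˡ (neq-avoiding l a b)) (lem′ _ _ _ _ _)))) ⟩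
    ∫ (λ a → ∫ (λ b → W a b * L (suc l) a + W a b * L (suc l) b + W a b * - P l))
      ≈⟨ ∫-cong (λ a → trans (∫-+ _ _) (+-cong (∫-+ _ _) (∫-*ʳ _ _))) ⟩
    ∫ (λ a → ∫ (λ b → W a b * L (suc l) a) + ∫ (λ b → W a b * L (suc l) b) + ∫ (W a) * - P l)
      ≈⟨ trans (∫-+ _ _) (+-cong (∫-+ _ _) (∫-*ʳ _ _)) ⟩
    ∫ (λ a → ∫ (λ b → W a b * L (suc l) a)) + ∫ (λ a → ∫ (λ b → W a b * L (suc l) b)) + C (suc j) * - P l
      ≈⟨ +-congʳ (+-cong (∫-cong (λ a → ∫-*ʳ _ _))
           (trans (∫-swap (λ a b → W a b * L (suc l) b)) (∫-cong (λ b → trans (∫-*ʳ _ _)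
             (*-congʳ (trans (∫-cong (λ a → *-comm _ _)) (sym (M-suc j b b)))))))) ⟩
    T (suc j) (suc l) + T (suc j) (suc l) + C (suc j) * - P l ≈⟨ lem″ _ _ _ ⟩
    Y (suc j) l ∎
    where
    W : ℕ → ℕ → Carrier
    W a b = neq a b * M j b a
    lem = solve 3 (λ p q r → p :* (q :* r) := q :* (p :* r)) refl
    lem′ = solve 5 (λ m ab x y z →
      m :* (ab :* (x :+ y :+ z)) :=
      ab :* m :* x :+ ab :* m :* y :+ ab :* m :* z) refl
    lem″ = solve 3 (λ t c p → t :+ t :+ c :* (:- p) := t :+ t :- c :* p) refl

  S-lineTadpole-indicators : ∀ j l (u v : Fin (suc (suc j))) → ConsecutiveOnCycle u v ⊎ ConsecutiveOnCycle v u →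
    ∀ (w : Fin (suc l)) → toℕ w ≡ 0 ⊎ suc (toℕ w) ≡ suc l →
    ∫ (λ r → S (suc j) (λ x → ∫ (λ s → S l (λ y → ⟨ does (walk? r x r) ⟩ * (⟨ does (link? s y) ⟩ *
      (neq (lookup (r ∷ x) u) (lookup (s ∷ y) w) * neq (lookup (r ∷ x) v) (lookup (s ∷ y) w))))))) ≈
    Y (suc j) l
  S-lineTadpole-indicators j l u v uv w w-end = begin
    _ ≈⟨ ∫-cong (λ r → S-cong (suc j) (λ x → trans (∫-cong (λ s → S-*ˡ l _ _)) (trans (∫-*ˡ _ _)
           (*-congˡ {⟨ does (walk? r x r) ⟩} (S-link-end l w w-end
             (λ c → neq (lookup (r ∷ x) u) c * neq (lookup (r ∷ x) v) c)))))) ⟩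
    ∫ (λ r → S (suc j) (λ x → ⟨ does (walk? r x r) ⟩ * avoiding l (lookup (r ∷ x) u) (lookup (r ∷ x) v)))
      ≈⟨ on-cycle uv ⟩
    ∫ (λ a → ∫ (λ b → neq a b * (M j b a * avoiding l a b))) ≈⟨ ∫∫-avoiding j l ⟩
    Y (suc j) l ∎
    where
    on-cycle : ConsecutiveOnCycle u v ⊎ ConsecutiveOnCycle v u →
      ∫ (λ r → S (suc j) (λ x → ⟨ does (walk? r x r) ⟩ * avoiding l (lookup (r ∷ x) u) (lookup (r ∷ x) v))) ≈
      ∫ (λ a → ∫ (λ b → neq a b * (M j b a * avoiding l a b)))
    on-cycle (inj₁ e) = S-cycle j u v e (avoiding l)
    on-cycle (inj₂ e) = trans
      (∫-cong (λ r → S-cong (suc j) (λ x → *-congˡ {⟨ does (walk? r x r) ⟩}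
        (avoiding-comm l (lookup (r ∷ x) u) (lookup (r ∷ x) v)))))
      (S-cycle j v u e (avoiding l))

  -- The graph enters only as a Boolean `p` with its factorisation, which keeps this half
  -- independent of how graphs are encoded.
  S-lineTadpole : ∀ j l (u v : Fin (suc (suc j))) → ConsecutiveOnCycle u v ⊎ ConsecutiveOnCycle v u →
    ∀ (w : Fin (suc l)) → toℕ w ≡ 0 ⊎ suc (toℕ w) ≡ suc l → ∀ (p : Vec ℕ (suc (suc j) ℕ.+ suc l) → Bool) →
    (∀ r x s y → p ((r ∷ x) ++ (s ∷ y)) ≡ does (walk? r x r) ∧ (does (link? s y) ∧
      (not (does (lookup (r ∷ x) u ≟ lookup (s ∷ y) w)) ∧ not (does (lookup (r ∷ x) v ≟ lookup (s ∷ y) w))))) →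
    S (suc (suc j) ℕ.+ suc l) (λ κ → ⟨ p κ ⟩) ≈ Y (suc j) l
  S-lineTadpole j l u v uv w w-end p p≡ = begin
    S (suc (suc j) ℕ.+ suc l) (λ κ → ⟨ p κ ⟩) ≈⟨ S-++ (suc (suc j)) (suc l) (λ κ → ⟨ p κ ⟩) ⟩
    ∫ (λ r → S (suc j) (λ x → ∫ (λ s → S l (λ y → ⟨ p ((r ∷ x) ++ (s ∷ y)) ⟩))))
      ≈⟨ ∫-cong (λ r → S-cong (suc j) (λ x → ∫-cong (λ s → S-cong l (λ y →
           trans (reflexive (≡.cong ⟨_⟩ (p≡ r x s y))) (trans (⟨∧⟩ _ _) (*-congˡ {⟨ does (walk? r x r) ⟩}
             (trans (⟨∧⟩ _ _) (*-congˡ {⟨ does (link? s y) ⟩}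
               (⟨∧⟩ (not (does (lookup (r ∷ x) u ≟ lookup (s ∷ y) w))) _))))))))) ⟩
    _ ≈⟨ S-lineTadpole-indicators j l u v uv w w-end ⟩
    Y (suc j) l ∎

-- The ring of formal power series

open import Defs
import Algebra.Properties.CommutativeSemigroup ℤₚ.+-commutativeSemigroup as ℤ-+
open CommutativeRing ℤₚ.+-*-commutativeRing using (+-congˡ)

module _ where
  open ≡.≡-Reasoning
  open ≡ using (refl; sym; trans; cong; cong₂)

  Σ< : ℕ → (ℕ → ℤ) → ℤ
  Σ< zero    h = 0ℤ
  Σ< (suc n) h = h 0 ℤ.+ Σ< n (h ∘ suc)

  sumℤ-applyUpTo : ∀ (h : ℕ → ℤ) φ n → sumℤ (map h (applyUpTo φ n)) ≡ Σ< n (h ∘ φ)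
  sumℤ-applyUpTo h φ zero    = refl
  sumℤ-applyUpTo h φ (suc n) = +-congˡ {h (φ 0)} (sumℤ-applyUpTo h (φ ∘ suc) n)

  sumℤ-++ : ∀ xs ys → sumℤ (xs List.++ ys) ≡ sumℤ xs ℤ.+ sumℤ ys
  sumℤ-++ []       ys = sym (ℤₚ.+-identityˡ _)
  sumℤ-++ (x ∷ xs) ys = trans (+-congˡ {x} (sumℤ-++ xs ys)) (sym (ℤₚ.+-assoc x (sumℤ xs) (sumℤ ys)))

  sumℤ-cartesianProductWith : ∀ {A B C : Set} (h : C → ℤ) (k : A → B → C) xs ys →
    sumℤ (map h (cartesianProductWith k xs ys)) ≡ sumℤ (map (λ x → sumℤ (map (h ∘ k x) ys)) xs)
  sumℤ-cartesianProductWith h k []       ys = refl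
  sumℤ-cartesianProductWith h k (x ∷ xs) ys = begin
    sumℤ (map h (map (k x) ys List.++ cartesianProductWith k xs ys))
      ≡⟨ cong sumℤ (map-++ h (map (k x) ys) _) ⟩
    sumℤ (map h (map (k x) ys) List.++ map h (cartesianProductWith k xs ys))
      ≡⟨ sumℤ-++ (map h (map (k x) ys)) _ ⟩
    sumℤ (map h (map (k x) ys)) ℤ.+ sumℤ (map h (cartesianProductWith k xs ys))
      ≡⟨ cong₂ ℤ._+_ (cong sumℤ (sym (Listₚ.map-∘ ys))) (sumℤ-cartesianProductWith h k xs ys) ⟩
    _ ∎

  -- Δ a h = Σ_{i + j = a} h i j
  Δ : ℕ → (ℕ → ℕ → ℤ) → ℤ
  Δ zero    h = h 0 0
  Δ (suc a) h = h 0 (suc a) ℤ.+ Δ a (λ i j → h (suc i) j)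

  Δ-cong : ∀ a {h k} → (∀ i j → h i j ≡ k i j) → Δ a h ≡ Δ a k
  Δ-cong zero    eq = eq 0 0
  Δ-cong (suc a) eq = cong₂ ℤ._+_ (eq 0 (suc a)) (Δ-cong a (λ i j → eq (suc i) j))

  Δ-+ : ∀ a h k → Δ a (λ i j → h i j ℤ.+ k i j) ≡ Δ a h ℤ.+ Δ a k
  Δ-+ zero    h k = refl
  Δ-+ (suc a) h k = trans (+-congˡ {h 0 (suc a) ℤ.+ k 0 (suc a)} (Δ-+ a (h ∘ suc) (k ∘ suc)))
    (ℤ-+.interchange (h 0 (suc a)) (k 0 (suc a)) (Δ a (h ∘ suc)) (Δ a (k ∘ suc)))

  Δ-0 : ∀ a {h} → (∀ i j → h i j ≡ 0ℤ) → Δ a h ≡ 0ℤ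
  Δ-0 zero    eq = eq 0 0
  Δ-0 (suc a) eq = trans (cong₂ ℤ._+_ (eq _ _) (Δ-0 a (λ i j → eq (suc i) j))) refl

  Δ-first : ∀ a {h} → (∀ i j → h (suc i) j ≡ 0ℤ) → Δ a h ≡ h 0 a
  Δ-first zero    eq = refl
  Δ-first (suc a) {h} eq = trans (+-congˡ {h 0 (suc a)} (Δ-0 a eq)) (ℤₚ.+-identityʳ _)

  Δ-last : ∀ a h → Δ (suc a) h ≡ Δ a (λ i j → h i (suc j)) ℤ.+ h (suc a) 0
  Δ-last zero    h = refl
  Δ-last (suc a) h = trans (+-congˡ {h 0 (suc (suc a))} (Δ-last a (h ∘ suc)))
    (sym (ℤₚ.+-assoc (h 0 (suc (suc a))) (Δ a (λ i j → h (suc i) (suc j))) (h (suc (suc a)) 0)))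

  Δ-comm : ∀ a h → Δ a h ≡ Δ a (λ i j → h j i)
  Δ-comm zero    h = refl
  Δ-comm (suc a) h = begin
    h 0 (suc a) ℤ.+ Δ a (λ i j → h (suc i) j) ≡⟨ ℤₚ.+-comm (h 0 (suc a)) _ ⟩
    Δ a (λ i j → h (suc i) j) ℤ.+ h 0 (suc a) ≡⟨ cong (ℤ._+ h 0 (suc a)) (Δ-comm a (h ∘ suc)) ⟩
    Δ a (λ i j → h (suc j) i) ℤ.+ h 0 (suc a) ≡⟨ Δ-last a (λ i j → h j i) ⟨
    Δ (suc a) (λ i j → h j i) ∎

  -- Both sides run over the triples with p + q + k = a.
  Δ-assoc : ∀ a (h : ℕ → ℕ → ℕ → ℤ) →
    Δ a (λ i k → Δ i (λ p q → h p q k)) ≡ Δ a (λ p j → Δ j (λ q k → h p q k))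
  Δ-assoc zero    h = refl
  Δ-assoc (suc a) h = begin
    h 0 0 (suc a) ℤ.+ Δ a (λ i k → h 0 (suc i) k ℤ.+ Δ i (λ p q → h (suc p) q k))
      ≡⟨ +-congˡ {h 0 0 (suc a)} (Δ-+ a (λ i k → h 0 (suc i) k) (λ i k → Δ i (λ p q → h (suc p) q k))) ⟩
    h 0 0 (suc a) ℤ.+ (Δ a (λ i k → h 0 (suc i) k) ℤ.+ Δ a (λ i k → Δ i (λ p q → h (suc p) q k)))
      ≡⟨ ℤₚ.+-assoc (h 0 0 (suc a)) (Δ a (λ i k → h 0 (suc i) k)) _ ⟨
    Δ (suc a) (h 0) ℤ.+ Δ a (λ i k → Δ i (λ p q → h (suc p) q k))
      ≡⟨ +-congˡ {Δ (suc a) (h 0)} (Δ-assoc a (h ∘ suc)) ⟩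
    Δ (suc a) (λ p j → Δ j (λ q k → h p q k)) ∎

  Σ<-Δ : ∀ a h → Σ< (suc a) (λ i → h i (a ℕ.∸ i)) ≡ Δ a h
  Σ<-Δ zero    h = ℤₚ.+-identityʳ _
  Σ<-Δ (suc a) h = +-congˡ {h 0 (suc a)} (Σ<-Δ a (λ i j → h (suc i) j))

  infix 8 _at_
  _at_ : Series → ℕ → Series
  (f at i) α = f (i ∷ α)

  -- A series is read as a power series in the first variable whose coefficients `f at i` are series
  -- in the others. The ring laws then follow by induction on the monomial, the laws of `Δ` handling
  -- the Cauchy product.
  *ˢ-∷ : ∀ f g a α → (f *ˢ g) (a ∷ α) ≡ Δ a (λ i j → (f at i *ˢ g at j) α)
  *ˢ-∷ f g a α = begin
    sumℤ (map (λ (β , γ) → f β ℤ.* g γ) (splits (a ∷ α)))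
      ≡⟨ sumℤ-cartesianProductWith _ _ (upTo (suc a)) (splits α) ⟩
    sumℤ (map (λ i → (f at i *ˢ g at (a ℕ.∸ i)) α) (upTo (suc a)))
      ≡⟨ sumℤ-applyUpTo (λ i → (f at i *ˢ g at (a ℕ.∸ i)) α) id (suc a) ⟩
    Σ< (suc a) (λ i → (f at i *ˢ g at (a ℕ.∸ i)) α) ≡⟨ Σ<-Δ a (λ i j → (f at i *ˢ g at j) α) ⟩
    Δ a (λ i j → (f at i *ˢ g at j) α) ∎

  *ˢ-cong : ∀ {f f′ g g′} → f ≈ f′ → g ≈ g′ → f *ˢ g ≈ f′ *ˢ g′
  *ˢ-cong f≈f′ g≈g′ α =
    cong sumℤ (Listₚ.map-cong (λ (β , γ) → cong₂ ℤ._*_ (f≈f′ β) (g≈g′ γ)) (splits α))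

  *ˢ-comm : ∀ f g → f *ˢ g ≈ g *ˢ f
  *ˢ-comm f g []      = cong (ℤ._+ 0ℤ) (ℤₚ.*-comm (f []) (g []))
  *ˢ-comm f g (a ∷ α) = begin
    (f *ˢ g) (a ∷ α)                     ≡⟨ *ˢ-∷ f g a α ⟩
    Δ a (λ i j → (f at i *ˢ g at j) α)   ≡⟨ Δ-cong a (λ i j → *ˢ-comm (f at i) (g at j) α) ⟩
    Δ a (λ i j → (g at j *ˢ f at i) α)   ≡⟨ Δ-comm a _ ⟩
    Δ a (λ i j → (g at i *ˢ f at j) α)   ≡⟨ *ˢ-∷ g f a α ⟨
    (g *ˢ f) (a ∷ α) ∎

  *ˢ-distribʳ : ∀ h f g → (f +ˢ g) *ˢ h ≈ f *ˢ h +ˢ g *ˢ h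
  *ˢ-distribʳ h f g []      = begin
    (f [] ℤ.+ g []) ℤ.* h [] ℤ.+ 0ℤ                     ≡⟨ ℤₚ.+-identityʳ _ ⟩
    (f [] ℤ.+ g []) ℤ.* h []                            ≡⟨ ℤₚ.*-distribʳ-+ (h []) (f []) (g []) ⟩
    f [] ℤ.* h [] ℤ.+ g [] ℤ.* h []
      ≡⟨ cong₂ ℤ._+_ (ℤₚ.+-identityʳ (f [] ℤ.* h [])) (ℤₚ.+-identityʳ (g [] ℤ.* h [])) ⟨
    f [] ℤ.* h [] ℤ.+ 0ℤ ℤ.+ (g [] ℤ.* h [] ℤ.+ 0ℤ) ∎
  *ˢ-distribʳ h f g (a ∷ α) = begin
    ((f +ˢ g) *ˢ h) (a ∷ α) ≡⟨ *ˢ-∷ (f +ˢ g) h a α ⟩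
    Δ a (λ i j → ((f at i +ˢ g at i) *ˢ h at j) α)
      ≡⟨ Δ-cong a (λ i j → *ˢ-distribʳ (h at j) (f at i) (g at i) α) ⟩
    Δ a (λ i j → (f at i *ˢ h at j) α ℤ.+ (g at i *ˢ h at j) α) ≡⟨ Δ-+ a _ _ ⟩
    Δ a (λ i j → (f at i *ˢ h at j) α) ℤ.+ Δ a (λ i j → (g at i *ˢ h at j) α)
      ≡⟨ cong₂ ℤ._+_ (*ˢ-∷ f h a α) (*ˢ-∷ g h a α) ⟨
    (f *ˢ h +ˢ g *ˢ h) (a ∷ α) ∎

  *ˢ-distribˡ : ∀ h f g → h *ˢ (f +ˢ g) ≈ h *ˢ f +ˢ h *ˢ g
  *ˢ-distribˡ h f g α = trans (*ˢ-comm h (f +ˢ g) α)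
    (trans (*ˢ-distribʳ h f g α) (cong₂ ℤ._+_ (*ˢ-comm f h α) (*ˢ-comm g h α)))

  *ˢ-zeroˡ : ∀ f → 0ˢ *ˢ f ≈ 0ˢ
  *ˢ-zeroˡ f []      = refl
  *ˢ-zeroˡ f (a ∷ α) = trans (*ˢ-∷ 0ˢ f a α) (Δ-0 a (λ i j → *ˢ-zeroˡ (f at j) α))

  *ˢ-identityˡ : ∀ f → 1ˢ *ˢ f ≈ f
  *ˢ-identityˡ f []      = trans (ℤₚ.+-identityʳ _) (ℤₚ.*-identityˡ _)
  *ˢ-identityˡ f (a ∷ α) = begin
    (1ˢ *ˢ f) (a ∷ α)                       ≡⟨ *ˢ-∷ 1ˢ f a α ⟩
    -- `1ˢ at 0` and `1ˢ at suc i` compute to `1ˢ` and `0ˢ`.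
    Δ a (λ i j → (1ˢ at i *ˢ f at j) α)     ≡⟨ Δ-first a (λ i j → *ˢ-zeroˡ (f at j) α) ⟩
    (1ˢ at 0 *ˢ f at a) α                   ≡⟨ *ˢ-identityˡ (f at a) α ⟩
    f (a ∷ α) ∎

  Δ-*ˢ : ∀ a (F : ℕ → ℕ → Series) g → (λ β → Δ a (λ i j → F i j β)) *ˢ g ≈ λ β → Δ a (λ i j → (F i j *ˢ g) β)
  Δ-*ˢ zero    F g β = refl
  Δ-*ˢ (suc a) F g β = trans
    (*ˢ-distribʳ g (F 0 (suc a)) (λ β → Δ a (λ i j → F (suc i) j β)) β)
    (+-congˡ {(F 0 (suc a) *ˢ g) β} (Δ-*ˢ a (F ∘ suc) g β))

  *ˢ-assoc : ∀ f g h → (f *ˢ g) *ˢ h ≈ f *ˢ (g *ˢ h)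
  *ˢ-assoc f g h []      = begin
    (f [] ℤ.* g [] ℤ.+ 0ℤ) ℤ.* h [] ℤ.+ 0ℤ ≡⟨ cong (λ z → z ℤ.* h [] ℤ.+ 0ℤ) (ℤₚ.+-identityʳ (f [] ℤ.* g [])) ⟩
    f [] ℤ.* g [] ℤ.* h [] ℤ.+ 0ℤ          ≡⟨ cong (ℤ._+ 0ℤ) (ℤₚ.*-assoc (f []) (g []) (h [])) ⟩
    f [] ℤ.* (g [] ℤ.* h []) ℤ.+ 0ℤ        ≡⟨ cong (λ z → f [] ℤ.* z ℤ.+ 0ℤ) (ℤₚ.+-identityʳ (g [] ℤ.* h [])) ⟨
    f [] ℤ.* (g [] ℤ.* h [] ℤ.+ 0ℤ) ℤ.+ 0ℤ ∎
  *ˢ-assoc f g h (a ∷ α) = begin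
    ((f *ˢ g) *ˢ h) (a ∷ α) ≡⟨ *ˢ-∷ (f *ˢ g) h a α ⟩
    Δ a (λ i k → ((f *ˢ g) at i *ˢ h at k) α)
      ≡⟨ Δ-cong a (λ i k → trans (*ˢ-cong (*ˢ-∷ f g i) (λ _ → refl) α)
           (Δ-*ˢ i (λ p q → f at p *ˢ g at q) (h at k) α)) ⟩
    Δ a (λ i k → Δ i (λ p q → ((f at p *ˢ g at q) *ˢ h at k) α))
      ≡⟨ Δ-cong a (λ i k → Δ-cong i (λ p q → *ˢ-assoc (f at p) (g at q) (h at k) α)) ⟩
    Δ a (λ i k → Δ i (λ p q → (f at p *ˢ (g at q *ˢ h at k)) α)) ≡⟨ Δ-assoc a _ ⟩
    Δ a (λ p j → Δ j (λ q k → (f at p *ˢ (g at q *ˢ h at k)) α))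
      ≡⟨ Δ-cong a (λ p j → sym (trans (*ˢ-cong {f = f at p} (λ _ → refl) (*ˢ-∷ g h j) α)
           (trans (*ˢ-comm (f at p) _ α)
           (trans (Δ-*ˢ j (λ q k → g at q *ˢ h at k) (f at p) α) (Δ-cong j (λ q k → *ˢ-comm _ (f at p) α)))))) ⟩
    Δ a (λ p j → (f at p *ˢ (g *ˢ h) at j) α) ≡⟨ *ˢ-∷ f (g *ˢ h) a α ⟨
    (f *ˢ (g *ˢ h)) (a ∷ α) ∎

-- Functions that see trailing zeros belong to the carrier too. Multiplication keeps the length of
-- an exponent list, so the laws hold for each number of variables separately.
seriesRing : CommutativeRing 0ℓ 0ℓ
seriesRing = record
  { Carrier = Series
  ; _≈_ = _≈_
  ; _+_ = _+ˢ_
  ; _*_ = _*ˢ_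
  ; -_ = λ f α → ℤ.- f α
  ; 0# = 0ˢ
  ; 1# = 1ˢ
  ; isCommutativeRing = record
    { isRing = record
      { +-isAbelianGroup = Pointwise.isAbelianGroup Monomial ℤₚ.+-0-isAbelianGroup
      ; *-cong = *ˢ-cong
      ; *-assoc = *ˢ-assoc
      ; *-identity = *ˢ-identityˡ , λ f α → ≡.trans (*ˢ-comm f 1ˢ α) (*ˢ-identityˡ f α)
      ; distrib = *ˢ-distribˡ , *ˢ-distribʳ
      }
    ; *-comm = *ˢ-comm
    }
  }

-- Summation over all letters in the series ring

module _ where
  open ≡.≡-Reasoning
  open ≡ using (refl; sym; trans; cong; cong₂)

  -- Multiplication by the first variable.
  shift : Series → ℕ → Series
  shift f zero    = 0ˢ
  shift f (suc a) = f at a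

  -- ∫ F is the sum of the x_c F(c) over all letters c.
  ∫ˢ : (ℕ → Series) → Series
  -- Only letters below the length of the monomial can contribute, so the infinite sum ends here.
  ∫ˢ F []      = 0ℤ
  ∫ˢ F (a ∷ α) = shift (F 0) a α ℤ.+ ∫ˢ (λ c → F (suc c) at a) α

  shift-cong : ∀ {f g} → f ≈ g → ∀ a → shift f a ≈ shift g a
  shift-cong f≈g zero    α = refl
  shift-cong f≈g (suc a) α = f≈g (a ∷ α)

  ∫ˢ-cong : ∀ {F G} → (∀ c → F c ≈ G c) → ∫ˢ F ≈ ∫ˢ G
  ∫ˢ-cong F≈G []      = refl
  ∫ˢ-cong F≈G (a ∷ α) =
    cong₂ ℤ._+_ (shift-cong (F≈G 0) a α) (∫ˢ-cong (λ c β → F≈G (suc c) (a ∷ β)) α)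

  shift-+ : ∀ f g a → shift (f +ˢ g) a ≈ shift f a +ˢ shift g a
  shift-+ f g zero    α = refl
  shift-+ f g (suc a) α = refl

  ∫ˢ-+ : ∀ F G → ∫ˢ (λ c → F c +ˢ G c) ≈ ∫ˢ F +ˢ ∫ˢ G
  ∫ˢ-+ F G []      = refl
  ∫ˢ-+ F G (a ∷ α) = trans (cong₂ ℤ._+_ (shift-+ (F 0) (G 0) a α) (∫ˢ-+ _ _ α))
    (ℤ-+.interchange (shift (F 0) a α) _ _ _)

  ∫ˢ-0 : ∫ˢ (λ _ → 0ˢ) ≈ 0ˢ
  ∫ˢ-0 []            = refl
  ∫ˢ-0 (zero ∷ α)    = trans (ℤₚ.+-identityˡ _) (∫ˢ-0 α)
  ∫ˢ-0 (suc a ∷ α)   = trans (ℤₚ.+-identityˡ _) (∫ˢ-0 α)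

  ∫ˢ-Δ : ∀ a (F : ℕ → ℕ → ℕ → Series) → ∫ˢ (λ c β → Δ a (λ i j → F i j c β)) ≈ λ α → Δ a (λ i j → ∫ˢ (F i j) α)
  ∫ˢ-Δ zero    F α = refl
  ∫ˢ-Δ (suc a) F α = trans (∫ˢ-+ (F 0 (suc a)) (λ c β → Δ a (λ i j → F (suc i) j c β)) α)
    (+-congˡ {∫ˢ (F 0 (suc a)) α} (∫ˢ-Δ a (F ∘ suc) α))

  Δ-shift : ∀ f g a α → Δ a (λ i j → (f at i *ˢ shift g j) α) ≡ shift (f *ˢ g) a α
  Δ-shift f g zero    α = trans (*ˢ-comm (f at 0) 0ˢ α) (*ˢ-zeroˡ (f at 0) α)
  Δ-shift f g (suc a) α = begin
    Δ (suc a) (λ i j → (f at i *ˢ shift g j) α) ≡⟨ Δ-last a (λ i j → (f at i *ˢ shift g j) α) ⟩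
    Δ a (λ i j → (f at i *ˢ g at j) α) ℤ.+ (f at (suc a) *ˢ 0ˢ) α
      ≡⟨ cong₂ ℤ._+_ (sym (*ˢ-∷ f g a α)) (trans (*ˢ-comm (f at (suc a)) 0ˢ α) (*ˢ-zeroˡ (f at (suc a)) α)) ⟩
    (f *ˢ g) (a ∷ α) ℤ.+ 0ℤ ≡⟨ ℤₚ.+-identityʳ _ ⟩
    (f *ˢ g) (a ∷ α) ∎

  *ˢ-∫ˢ : ∀ f F → f *ˢ ∫ˢ F ≈ ∫ˢ (λ c → f *ˢ F c)
  *ˢ-∫ˢ f F []      = trans (ℤₚ.+-identityʳ _) (ℤₚ.*-zeroʳ (f []))
  *ˢ-∫ˢ f F (a ∷ α) = begin
    (f *ˢ ∫ˢ F) (a ∷ α) ≡⟨ *ˢ-∷ f (∫ˢ F) a α ⟩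
    Δ a (λ i j → (f at i *ˢ (shift (F 0) j +ˢ ∫ˢ (λ c → F (suc c) at j))) α)
      ≡⟨ Δ-cong a (λ i j → *ˢ-distribˡ (f at i) (shift (F 0) j) _ α) ⟩
    Δ a (λ i j → (f at i *ˢ shift (F 0) j) α ℤ.+ (f at i *ˢ ∫ˢ (λ c → F (suc c) at j)) α)
      ≡⟨ Δ-+ a _ _ ⟩
    Δ a (λ i j → (f at i *ˢ shift (F 0) j) α) ℤ.+ Δ a (λ i j → (f at i *ˢ ∫ˢ (λ c → F (suc c) at j)) α)
      ≡⟨ cong₂ ℤ._+_ (Δ-shift f (F 0) a α) (Δ-cong a (λ i j → *ˢ-∫ˢ (f at i) (λ c → F (suc c) at j) α)) ⟩
    shift (f *ˢ F 0) a α ℤ.+ Δ a (λ i j → ∫ˢ (λ c → f at i *ˢ F (suc c) at j) α)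
      ≡⟨ +-congˡ {shift (f *ˢ F 0) a α} (∫ˢ-Δ a (λ i j c → f at i *ˢ F (suc c) at j) α) ⟨
    shift (f *ˢ F 0) a α ℤ.+ ∫ˢ (λ c β → Δ a (λ i j → (f at i *ˢ F (suc c) at j) β)) α
      ≡⟨ +-congˡ {shift (f *ˢ F 0) a α} (∫ˢ-cong (λ c β → sym (*ˢ-∷ f (F (suc c)) a β)) α) ⟩
    ∫ˢ (λ c → f *ˢ F c) (a ∷ α) ∎

module _ where
  open ≡ using (refl; sym; trans; cong; cong₂)
  open SimpleGraph

  -- Proper colourings

  -- `fromRel` symmetrises its relation and `≢` is symmetric, so checking one orientation suffices.
  ⇒proper : ∀ {n} {E : Fin n → Fin n → Set} {κ : Vec ℕ n} →
    (∀ u v → u ≢ v → E u v → lookup κ u ≢ lookup κ v) →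
    ∀ u v → u ≢ v × (E u v ⊎ E v u) → lookup κ u ≢ lookup κ v
  ⇒proper h u v (u≢v , inj₁ e) = h u v u≢v e
  ⇒proper h u v (u≢v , inj₂ e) = ≢-sym (h v u (≢-sym u≢v) e)

  -- `a ≢ b` excludes the loop, which `fromRel` would silently discard.
  proper-addEdge : ∀ {n} (G : SimpleGraph n) {a b} → a ≢ b → ∀ (κ : Vec ℕ n) →
    Proper (addEdge G a b) κ ⇔ (Proper G κ × lookup κ a ≢ lookup κ b)
  proper-addEdge G {a} {b} a≢b κ = mk⇔
    (λ proper → (λ u v e → proper u v ((λ { refl → ~-irrefl G e }) , inj₁ (inj₁ e))) ,
                proper a b (a≢b , inj₁ (inj₂ (refl , refl))))
    (λ { (proper , a≁b) → ⇒proper {κ = κ}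
      λ { u v _ (inj₁ e) → proper u v e ; u v _ (inj₂ (refl , refl)) → a≁b } })

  module _ {m n} (G : SimpleGraph m) (H : SimpleGraph n) (x : Vec ℕ m) (y : Vec ℕ n) where

    private
      Edge : Fin m ⊎ Fin n → Fin m ⊎ Fin n → Set
      Edge = Pointwise (_~_ G) (_~_ H)

    proper-⊔ : Proper (G ⊔ᴳ H) (x ++ y) ⇔ (Proper G x × Proper H y)
    proper-⊔ = mk⇔ (λ proper → left proper , right proper)
                   (λ (p , q) → ⇒proper {κ = x ++ y} λ a b _ → join p q a b)
      where
      left : Proper (G ⊔ᴳ H) (x ++ y) → Proper G x
      left proper u v e eq = proper (u ↑ˡ n) (v ↑ˡ n)
        ( (λ u≡v → ~-irrefl G (≡.subst (_~_ G u) (sym (Finₚ.↑ˡ-injective n u v u≡v)) e))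
        , inj₁ (≡.subst₂ Edge (sym (Finₚ.splitAt-↑ˡ m u n)) (sym (Finₚ.splitAt-↑ˡ m v n)) (inj₁ e)))
        (trans (lookup-++ˡ x y u) (trans eq (sym (lookup-++ˡ x y v))))

      right : Proper (G ⊔ᴳ H) (x ++ y) → Proper H y
      right proper u v e eq = proper (m ↑ʳ u) (m ↑ʳ v)
        ( (λ u≡v → ~-irrefl H (≡.subst (_~_ H u) (sym (Finₚ.↑ʳ-injective m u v u≡v)) e))
        , inj₁ (≡.subst₂ Edge (sym (Finₚ.splitAt-↑ʳ m n u)) (sym (Finₚ.splitAt-↑ʳ m n v)) (inj₂ e)))
        (trans (lookup-++ʳ x y u) (trans eq (sym (lookup-++ʳ x y v))))

      join : Proper G x → Proper H y → ∀ a b → Edge (splitAt m a) (splitAt m b) →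
        lookup (x ++ y) a ≢ lookup (x ++ y) b
      join p q a b e eq with splitAt m a in a≡ | splitAt m b in b≡
      join p q a b (inj₁ e) eq | inj₁ u | inj₁ v
        with refl ← Finₚ.splitAt⁻¹-↑ˡ {i = a} a≡ | refl ← Finₚ.splitAt⁻¹-↑ˡ {i = b} b≡ =
        p u v e (trans (sym (lookup-++ˡ x y u)) (trans eq (lookup-++ˡ x y v)))
      join p q a b (inj₂ e) eq | inj₂ u | inj₂ v
        with refl ← Finₚ.splitAt⁻¹-↑ʳ {i = a} a≡ | refl ← Finₚ.splitAt⁻¹-↑ʳ {i = b} b≡ =
        q u v e (trans (sym (lookup-++ʳ x y u)) (trans eq (lookup-++ʳ x y v)))

  StepsDiffer : ∀ {n} → Vec ℕ n → Set
  StepsDiffer κ = ∀ u v → suc (toℕ u) ≡ toℕ v → lookup κ u ≢ lookup κ v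

  LastDiffers : ∀ {n} → Vec ℕ n → ℕ → Set
  LastDiffers {n} κ s = ∀ u → suc (toℕ u) ≡ n → lookup κ u ≢ s

  link-steps : ∀ {n} r (w : Vec ℕ n) → Link r w ⇔ StepsDiffer (r ∷ w)
  link-steps r w = mk⇔ (to r w) (from r w)
    where
    to : ∀ {n} r (w : Vec ℕ n) → Link r w → StepsDiffer (r ∷ w)
    to r (c ∷ w) (r≢c , _) zero    (suc zero) _  = r≢c
    to r (c ∷ w) (_ , l)   (suc u) (suc v)    eq = to c w l u v (ℕₚ.suc-injective eq)
    from : ∀ {n} r (w : Vec ℕ n) → StepsDiffer (r ∷ w) → Link r w
    from r []      h = tt
    from r (c ∷ w) h = h zero (suc zero) refl , from c w (λ u v eq → h (suc u) (suc v) (cong suc eq))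

  walk-steps : ∀ {n} r (w : Vec ℕ n) s → Walk r w s ⇔ (StepsDiffer (r ∷ w) × LastDiffers (r ∷ w) s)
  walk-steps r w s = mk⇔
    (λ walk → Equivalence.to (link-steps r w) (link r w walk) , last r w walk)
    (λ (steps , last) → from r w (Equivalence.from (link-steps r w) steps) last)
    where
    link : ∀ {n} r (w : Vec ℕ n) → Walk r w s → Link r w
    link r []      _           = tt
    link r (c ∷ w) (r≢c , walk) = r≢c , link c w walk
    last : ∀ {n} r (w : Vec ℕ n) → Walk r w s → LastDiffers (r ∷ w) s
    last r []      r≢s        zero    _  = r≢s
    last r (c ∷ w) (_ , walk) (suc u) eq = last c w walk u (ℕₚ.suc-injective eq)
    from : ∀ {n} r (w : Vec ℕ n) → Link r w → LastDiffers (r ∷ w) s → Walk r w s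
    from r []      _         last = last zero refl
    from r (c ∷ w) (r≢c , l) last = r≢c , from c w l (λ u eq → last (suc u) (cong suc eq))

  private
    step-≢ : ∀ {n} {u v : Fin n} → suc (toℕ u) ≡ toℕ v → u ≢ v
    step-≢ eq refl = ℕₚ.1+n≢n eq

  proper-path : ∀ {l} s (y : Vec ℕ l) → Proper (path (suc l)) (s ∷ y) ⇔ Link s y
  proper-path s y = mk⇔
    (λ proper → Equivalence.from (link-steps s y) (λ u v eq → proper u v (step-≢ eq , inj₁ eq)))
    (λ l → ⇒proper {κ = s ∷ y} (λ u v _ eq → Equivalence.to (link-steps s y) l u v eq))

  proper-cycle : ∀ {k} r (x : Vec ℕ (suc k)) → Proper (cycle (suc (suc k))) (r ∷ x) ⇔ Walk r x r
  proper-cycle {k} r x = mk⇔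
    (λ proper → Equivalence.from (walk-steps r x r)
      ( (λ u v eq → proper u v (step-≢ eq , inj₁ (inj₁ eq)))
      -- With at least two vertices the last one differs from vertex 0, so the closing edge is no
      -- loop.
      , (λ u eq → proper u zero ((λ { refl → case-0 eq }) , inj₁ (inj₂ (eq , refl))))))
    (λ walk → ⇒proper {κ = r ∷ x} λ
      { u v    _ (inj₁ eq)         → proj₁ (Equivalence.to (walk-steps r x r) walk) u v eq
      ; u zero _ (inj₂ (eq , _))   → proj₂ (Equivalence.to (walk-steps r x r) walk) u eq })
    where
    case-0 : suc zero ≢ suc (suc k)
    case-0 ()

  proper-lineTadpole : ∀ j l (u v : Fin (suc (suc j))) (w : Fin (suc l)) r (x : Vec ℕ (suc j)) s (y : Vec ℕ l) →
    Proper (lineTadpole (suc (suc j)) (suc l) u v w) ((r ∷ x) ++ (s ∷ y)) ⇔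
    (Walk r x r × Link s y × lookup (r ∷ x) u ≢ lookup (s ∷ y) w × lookup (r ∷ x) v ≢ lookup (s ∷ y) w)
  proper-lineTadpole j l u v w r x s y = mk⇔
    (λ proper →
      let proper′ , v≁w = to (proper-addEdge G′ (↑ˡ≢↑ʳ v) κ) proper
          proper″ , u≁w = to (proper-addEdge G (↑ˡ≢↑ʳ u) κ) proper′
          cyc , pth = to (proper-⊔ (cycle m) (path n) (r ∷ x) (s ∷ y)) proper″
      in to (proper-cycle r x) cyc , to (proper-path s y) pth ,
         (λ eq → u≁w (trans (lookup-++ˡ (r ∷ x) (s ∷ y) u) (trans eq (sym (lookup-++ʳ (r ∷ x) (s ∷ y) w))))) ,
         (λ eq → v≁w (trans (lookup-++ˡ (r ∷ x) (s ∷ y) v) (trans eq (sym (lookup-++ʳ (r ∷ x) (s ∷ y) w))))))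
    (λ (walk , link , u≁w , v≁w) →
      from (proper-addEdge G′ (↑ˡ≢↑ʳ v) κ)
        ( from (proper-addEdge G (↑ˡ≢↑ʳ u) κ)
            ( from (proper-⊔ (cycle m) (path n) (r ∷ x) (s ∷ y))
                (from (proper-cycle r x) walk , from (proper-path s y) link)
            , (λ eq → u≁w (trans (sym (lookup-++ˡ (r ∷ x) (s ∷ y) u)) (trans eq (lookup-++ʳ (r ∷ x) (s ∷ y) w)))))
        , (λ eq → v≁w (trans (sym (lookup-++ˡ (r ∷ x) (s ∷ y) v)) (trans eq (lookup-++ʳ (r ∷ x) (s ∷ y) w))))))
    where
    open Equivalence using (to; from)
    m = suc (suc j)
    n = suc l
    κ = (r ∷ x) ++ (s ∷ y)
    G = cycle m ⊔ᴳ path n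
    G′ = addEdge G (u ↑ˡ n) (m ↑ʳ w)
    ↑ˡ≢↑ʳ : ∀ i → i ↑ˡ n ≢ m ↑ʳ w
    ↑ˡ≢↑ʳ i eq with () ← trans (sym (Finₚ.splitAt-↑ˡ m i n)) (trans (cong (splitAt m) eq) (Finₚ.splitAt-↑ʳ m n w))

module _ where
  open ≡.≡-Reasoning
  open ≡ using (refl; sym; trans; cong; cong₂)

  private
    shift² : Series → ℕ → Series
    shift² f zero    = 0ˢ
    shift² f (suc a) = shift f a

    shift-∫ˢ : ∀ F a → shift (∫ˢ F) a ≈ shift² (F 0) a +ˢ ∫ˢ (λ d → shift (F (suc d)) a)
    shift-∫ˢ F zero    α = sym (trans (ℤₚ.+-identityˡ _) (∫ˢ-0 α))
    shift-∫ˢ F (suc a) α = refl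

  -- Each of the two letters is 0 or positive. The pair (0, 0) gives `z`, which carries the square
  -- of x_0; the mixed pairs give `p` and `q`; pairs of positive letters fall to the induction
  -- hypothesis on the shorter monomial.
  ∫ˢ-swap : ∀ (h : ℕ → ℕ → Series) → ∫ˢ (λ c → ∫ˢ (h c)) ≈ ∫ˢ (λ d → ∫ˢ (λ c → h c d))
  ∫ˢ-swap h []      = refl
  ∫ˢ-swap h (a ∷ α) = begin
    shift (∫ˢ (h 0)) a α ℤ.+ ∫ˢ (λ c → shift (h (suc c) 0) a +ˢ ∫ˢ (λ d → h (suc c) (suc d) at a)) α
      ≡⟨ cong₂ ℤ._+_ (shift-∫ˢ (h 0) a α) (∫ˢ-+ (λ c → shift (h (suc c) 0) a) _ α) ⟩
    (z ℤ.+ p) ℤ.+ (q ℤ.+ ∫ˢ (λ c → ∫ˢ (λ d → h (suc c) (suc d) at a)) α)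
      ≡⟨ ℤ-+.interchange z p q _ ⟩
    (z ℤ.+ q) ℤ.+ (p ℤ.+ ∫ˢ (λ c → ∫ˢ (λ d → h (suc c) (suc d) at a)) α)
      ≡⟨ +-congˡ {z ℤ.+ q} (+-congˡ {p} (∫ˢ-swap (λ c d → h (suc c) (suc d) at a) α)) ⟩
    (z ℤ.+ q) ℤ.+ (p ℤ.+ ∫ˢ (λ d → ∫ˢ (λ c → h (suc c) (suc d) at a)) α)
      ≡⟨ cong₂ ℤ._+_ (shift-∫ˢ (λ c → h c 0) a α) (∫ˢ-+ (λ d → shift (h 0 (suc d)) a) _ α) ⟨
    shift (∫ˢ (λ c → h c 0)) a α ℤ.+ ∫ˢ (λ d → shift (h 0 (suc d)) a +ˢ ∫ˢ (λ c → h (suc c) (suc d) at a)) α ∎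
    where
    z = shift² (h 0 0) a α
    p = ∫ˢ (λ d → shift (h 0 (suc d)) a) α
    q = ∫ˢ (λ c → shift (h (suc c) 0) a) α

seriesIntegral : Integral seriesRing
seriesIntegral = record
  { ∫ = ∫ˢ ; ∫-cong = ∫ˢ-cong ; ∫-+ = ∫ˢ-+ ; *-∫ = *ˢ-∫ˢ ; ∫-swap = ∫ˢ-swap }

open Integration seriesRing seriesIntegral

-- Coefficients of word sums as counts of words

module _ where
  open ≡.≡-Reasoning
  open ≡ using (refl; sym; trans; cong; cong₂)

  -- Multiplication by the variable x_c.
  mulVar : ℕ → Series → Series
  mulVar c       f []      = 0ℤ
  mulVar zero    f (a ∷ α) = shift f a α
  mulVar (suc c) f (a ∷ α) = mulVar c (f at a) α

  ∫ˢ-mulVar : ∀ F α → ∫ˢ F α ≡ Σ< (length α) (λ c → mulVar c (F c) α)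
  ∫ˢ-mulVar F []      = refl
  ∫ˢ-mulVar F (a ∷ α) = +-congˡ {shift (F 0) a α} (∫ˢ-mulVar (λ c → F (suc c) at a) α)

  incr : ℕ → Monomial → Monomial
  incr c       []      = []
  incr zero    (a ∷ α) = suc a ∷ α
  incr (suc c) (a ∷ α) = a ∷ incr c α

  incr-injective : ∀ c α β → incr c α ≡ incr c β → α ≡ β
  incr-injective c       []      []      eq = refl
  incr-injective zero    (a ∷ α) (b ∷ β) refl = refl
  incr-injective (suc c) (a ∷ α) (b ∷ β) eq =
    cong₂ _∷_ (Listₚ.∷-injectiveˡ eq) (incr-injective c α β (Listₚ.∷-injectiveʳ eq))
  incr-injective zero    []      (b ∷ β) ()
  incr-injective (suc c) []      (b ∷ β) ()
  incr-injective zero    (a ∷ α) []      ()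
  incr-injective (suc c) (a ∷ α) []      ()

  -- In the divisible case `β` is the quotient of `α` by x_c, so `mulVar c f` at `α` just reads off
  -- `f` at `β`.
  data Divisibility (c : ℕ) (α : Monomial) : Set where
    divisible   : ∀ β → α ≡ incr c β → length β ≡ length α →
                  (∀ f → mulVar c f α ≡ f β) → Divisibility c α
    indivisible : (∀ β → incr c β ≢ α) → (∀ f → mulVar c f α ≡ 0ℤ) → Divisibility c α

  divisibility : ∀ c α → c ℕ.< length α → Divisibility c α
  divisibility zero    (zero ∷ α)  _ = indivisible (λ { [] () ; (_ ∷ _) () }) (λ f → refl)
  divisibility zero    (suc a ∷ α) _ = divisible (a ∷ α) refl refl (λ f → refl)
  divisibility (suc c) (a ∷ α) (ℕ.s≤s c<) with divisibility c α c<
  ... | divisible β refl len val = divisible (a ∷ β) refl (cong suc len) (λ f → val (f at a))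
  ... | indivisible neq val = indivisible
    (λ { [] () ; (b ∷ β) eq → neq β (Listₚ.∷-injectiveʳ eq) }) (λ f → val (f at a))

  incr-applyUpTo : ∀ c k (h h′ : ℕ → ℕ) → (∀ d → h d ≡ (if does (d ≟ c) then suc else id) (h′ d)) →
    applyUpTo h k ≡ incr c (applyUpTo h′ k)
  incr-applyUpTo c       zero    h h′ eq = refl
  incr-applyUpTo zero    (suc k) h h′ eq = cong₂ _∷_ (eq 0) (applyUpTo-cong k (λ d → eq (suc d)))
    where
    applyUpTo-cong : ∀ k {h h′ : ℕ → ℕ} → (∀ d → h d ≡ h′ d) → applyUpTo h k ≡ applyUpTo h′ k
    applyUpTo-cong zero    eq = refl
    applyUpTo-cong (suc k) eq = cong₂ _∷_ (eq 0) (applyUpTo-cong k (eq ∘ suc))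
  incr-applyUpTo (suc c) (suc k) h h′ eq =
    cong₂ _∷_ (eq 0) (incr-applyUpTo c k (h ∘ suc) (h′ ∘ suc) (eq ∘ suc))

  wordMonomial-∷ : ∀ {n} k c (w : Vec ℕ n) → wordMonomial k (c ∷ w) ≡ incr c (wordMonomial k w)
  wordMonomial-∷ k c w = begin
    map (λ d → Vec.count (d ≟_) (c ∷ w)) (upTo k) ≡⟨ Listₚ.map-upTo _ k ⟩
    applyUpTo (λ d → Vec.count (d ≟_) (c ∷ w)) k
      ≡⟨ incr-applyUpTo c k _ (λ d → Vec.count (d ≟_) w) (λ d → refl) ⟩
    incr c (applyUpTo (λ d → Vec.count (d ≟_) w) k) ≡⟨ cong (incr c) (Listₚ.map-upTo _ k) ⟨
    incr c (wordMonomial k w) ∎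

  wordMonomial-[]-⇔ : ∀ k α → length α ≡ k → wordMonomial k [] ≡ α ⇔ All (_≡ 0) α
  wordMonomial-[]-⇔ k α refl = mk⇔
    (λ eq → ≡.subst (All (_≡ 0)) (trans (sym (Listₚ.map-upTo _ k)) eq) (Allₚ.applyUpTo⁺₂ _ k (λ _ → refl)))
    (λ all → trans (Listₚ.map-upTo _ k) (zeros α all))
    where
    zeros : ∀ α → All (_≡ 0) α → applyUpTo (λ _ → 0) (length α) ≡ α
    zeros []      []           = refl
    zeros (_ ∷ α) (refl ∷ all) = cong (0 ∷_) (zeros α all)

  indicator : Bool → ℤ
  indicator b = if b then 1ℤ else 0ℤ

  length-filter : ∀ {A : Set} {Q : Pred A 0ℓ} (Q? : Decidable Q) xs →
    + length (filter Q? xs) ≡ sumℤ (map (λ x → indicator (does (Q? x))) xs)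
  length-filter Q? []       = refl
  length-filter Q? (x ∷ xs) with does (Q? x)
  ... | true  = cong (λ z → 1ℤ ℤ.+ z) (length-filter Q? xs)
  ... | false = trans (length-filter Q? xs) (sym (ℤₚ.+-identityˡ _))

  sumℤ-0 : ∀ {A : Set} (xs : List A) → sumℤ (map (λ _ → 0ℤ) xs) ≡ 0ℤ
  sumℤ-0 []       = refl
  sumℤ-0 (_ ∷ xs) = trans (ℤₚ.+-identityˡ _) (sumℤ-0 xs)

  Σ<-cong : ∀ n {h h′ : ℕ → ℤ} → (∀ {i} → i ℕ.< n → h i ≡ h′ i) → Σ< n h ≡ Σ< n h′
  Σ<-cong zero    eq = refl
  Σ<-cong (suc n) eq = cong₂ ℤ._+_ (eq (ℕ.s≤s ℕ.z≤n)) (Σ<-cong n (λ i<n → eq (ℕ.s≤s i<n)))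

  -- Fixing the first letter `c` divides `α` by x_c. The alphabet size `k` is a separate argument
  -- because it has to stay put while `α` is replaced by the quotient.
  word-count : ∀ n k (p : Vec ℕ n → Bool) α → length α ≡ k →
    sumℤ (map (λ w → indicator (p w ∧ does (≡-dec _≟_ (wordMonomial k w) α))) (words k n)) ≡
    S n (λ w → ⟨ p w ⟩) α
  word-count zero k p α len
    rewrite does-⇔ (wordMonomial-[]-⇔ k α len) (≡-dec _≟_ (wordMonomial k []) α) (All.all? (_≟ 0) α)
    with p []
  ... | true  = ℤₚ.+-identityʳ _
  ... | false = refl
  word-count (suc n) k p α refl = begin
    sumℤ (map (summand α) (words k (suc n)))
      ≡⟨ sumℤ-cartesianProductWith (summand α) _∷_ (upTo k) (words k n) ⟩
    sumℤ (map (λ c → sumℤ (map (summand α ∘ (c ∷_)) (words k n))) (upTo k))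
      ≡⟨ sumℤ-applyUpTo (λ c → sumℤ (map (summand α ∘ (c ∷_)) (words k n))) id k ⟩
    Σ< k (λ c → sumℤ (map (summand α ∘ (c ∷_)) (words k n)))
      ≡⟨ Σ<-cong k (λ {c} c<k → term c (divisibility c α c<k)) ⟩
    Σ< k (λ c → mulVar c (S n (λ w → ⟨ p (c ∷ w) ⟩)) α)
      ≡⟨ ∫ˢ-mulVar (λ c → S n (λ w → ⟨ p (c ∷ w) ⟩)) α ⟨
    S (suc n) (λ w → ⟨ p w ⟩) α ∎
    where
    summand : Monomial → Vec ℕ (suc n) → ℤ
    summand α w = indicator (p w ∧ does (≡-dec _≟_ (wordMonomial k w) α))

    ∧-false : ∀ b → b ∧ false ≡ false
    ∧-false false = refl
    ∧-false true  = refl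

    term : ∀ c → Divisibility c α →
      sumℤ (map (summand α ∘ (c ∷_)) (words k n)) ≡ mulVar c (S n (λ w → ⟨ p (c ∷ w) ⟩)) α
    term c (indivisible neq val) = begin
      sumℤ (map (summand α ∘ (c ∷_)) (words k n))
        ≡⟨ cong sumℤ (Listₚ.map-cong (λ w → cong indicator (trans
             (cong (p (c ∷ w) ∧_) (dec-false (≡-dec _≟_ _ α)
               (λ eq → neq _ (trans (sym (wordMonomial-∷ k c w)) eq))))
             (∧-false _))) (words k n)) ⟩
      sumℤ (map (λ _ → 0ℤ) (words k n)) ≡⟨ sumℤ-0 (words k n) ⟩
      0ℤ ≡⟨ val _ ⟨
      mulVar c (S n (λ w → ⟨ p (c ∷ w) ⟩)) α ∎
    term c (divisible β α≡ len val) = begin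
      sumℤ (map (summand α ∘ (c ∷_)) (words k n))
        ≡⟨ cong sumℤ (Listₚ.map-cong (λ w → cong (λ b → indicator (p (c ∷ w) ∧ b))
             (does-⇔ (equiv w) (≡-dec _≟_ _ α) (≡-dec _≟_ _ β))) (words k n)) ⟩
      sumℤ (map (λ w → indicator (p (c ∷ w) ∧ does (≡-dec _≟_ (wordMonomial k w) β))) (words k n))
        ≡⟨ word-count n k (p ∘ (c ∷_)) β len ⟩
      S n (λ w → ⟨ p (c ∷ w) ⟩) β ≡⟨ val _ ⟨
      mulVar c (S n (λ w → ⟨ p (c ∷ w) ⟩)) α ∎
      where
      equiv : ∀ w → wordMonomial k (c ∷ w) ≡ α ⇔ wordMonomial k w ≡ β
      equiv w = mk⇔
        (λ eq → incr-injective c _ _ (trans (sym (wordMonomial-∷ k c w)) (trans eq α≡)))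
        (λ eq → trans (wordMonomial-∷ k c w) (trans (cong (incr c) eq) (sym α≡)))

  Σwords≈S : ∀ {n} {P : Pred (Vec ℕ n) 0ℓ} (P? : Decidable P) → Σwords P? ≈ S n (λ w → ⟨ does (P? w) ⟩)
  Σwords≈S {n} P? α = trans
    (length-filter (λ w → P? w ×-dec ≡-dec _≟_ (wordMonomial (length α) w) α) (words (length α) n))
    (word-count n (length α) (λ w → does (P? w)) α refl)

module R = CommutativeRing seriesRing

module _ where
  open import Relation.Binary.Reasoning.Setoid R.setoid

  -- Elementary symmetric functions

  -- `J` chooses its letters from the smallest upwards, as an increasing word does; `c <? d` unfolds
  -- to `suc c ≤? d`, the test behind `le (suc c) d`.
  S-increasing : ∀ n c → S n (λ w → ⟨ does (Vecᴸ.linked? _<?_ (c ∷ w)) ⟩) ≈ J n (suc c)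
  S-increasing zero    c = R.refl
  S-increasing (suc n) c = ∫ˢ-cong λ d → R.trans
    (S-cong n (λ w → ⟨∧⟩ (does (c <? d)) _))
    (R.trans (S-*ˡ n (le (suc c) d) _) (R.*-congˡ {le (suc c) d} (S-increasing n d)))

  e≈es : ∀ n → e n ≈ es n
  e≈es n = R.trans (Σwords≈S {n} (Vecᴸ.linked? _<?_)) (increasing n)
    where
    increasing : ∀ n → S n (λ w → ⟨ does (Vecᴸ.linked? _<?_ w) ⟩) ≈ es n
    increasing zero    = R.refl
    increasing (suc n) = ∫ˢ-cong λ c → R.trans (S-increasing n c) (R.sym (R.*-identityˡ (J n (suc c))))

  X-lineTadpole : ∀ j l (u v : Fin (suc (suc j))) → ConsecutiveOnCycle u v ⊎ ConsecutiveOnCycle v u →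
    ∀ (w : Fin (suc l)) → IsEnd w → X (lineTadpole (suc (suc j)) (suc l) u v w) ≈ Y (suc j) l
  X-lineTadpole j l u v uv w w-end = R.trans (Σwords≈S (proper? Γ))
    (S-lineTadpole j l u v uv w w-end (λ κ → does (proper? Γ κ)) λ r x s y →
      does-⇔ (proper-lineTadpole j l u v w r x s y) (proper? Γ ((r ∷ x) ++ (s ∷ y)))
        (walk? r x r ×-dec (link? s y ×-dec
          (¬? (lookup (r ∷ x) u ≟ lookup (s ∷ y) w) ×-dec ¬? (lookup (r ∷ x) v ≟ lookup (s ∷ y) w)))))
    where
    Γ = lineTadpole (suc (suc j)) (suc l) u v w

  -- Collecting equal partitions

  ≥-decTotalOrder = Flip.decTotalOrder ℕₚ.≤-decTotalOrder

  open InsertionSort ≥-decTotalOrder using (insert)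
  open InsertionSortₚ ≥-decTotalOrder using (insert-↭; insert-↗)

  addPart : ℕ → Partition → Partition
  addPart i (mkPartition ps dec pos) = mkPartition (insert (suc i) ps)
    (insert-↗ (suc i) dec) (All-resp-↭ (↭-sym (insert-↭ (suc i) ps)) (ℕ.s≤s ℕ.z≤n ∷ pos))

  product : List ℕ → Series
  product = List.foldr (λ i f → e i *ˢ f) 1ˢ

  product-insert : ∀ i ps → product (insert i ps) ≈ e i *ˢ product ps
  product-insert i []       = R.refl {e i *ˢ 1ˢ}
  product-insert i (p ∷ ps) with does (p ≤? i)
  ... | true  = R.refl {e i *ˢ (e p *ˢ product ps)}
  ... | false = begin
    e p *ˢ product (insert i ps) ≈⟨ R.*-congˡ {e p} (product-insert i ps) ⟩
    e p *ˢ (e i *ˢ product ps)   ≈⟨ R.*-assoc (e p) (e i) (product ps) ⟨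
    (e p *ˢ e i) *ˢ product ps   ≈⟨ R.*-congʳ {product ps} (R.*-comm (e p) (e i)) ⟩
    (e i *ˢ e p) *ˢ product ps   ≈⟨ R.*-assoc (e i) (e p) (product ps) ⟩
    e i *ˢ (e p *ˢ product ps)   ∎

  sumᴾ : List Partition → Series
  sumᴾ = List.foldr (λ λ′ f → eᴾ λ′ +ˢ f) 0ˢ

  sumᴾ-++ : ∀ ps qs → sumᴾ (ps List.++ qs) ≈ sumᴾ ps +ˢ sumᴾ qs
  sumᴾ-++ []       qs = R.sym (R.+-identityˡ (sumᴾ qs))
  sumᴾ-++ (p ∷ ps) qs = R.trans (R.+-congˡ {eᴾ p} (sumᴾ-++ ps qs)) (R.sym (R.+-assoc (eᴾ p) (sumᴾ ps) (sumᴾ qs)))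

  sumᴾ-addPart : ∀ i ps → sumᴾ (map (addPart i) ps) ≈ es (suc i) *ˢ sumᴾ ps
  sumᴾ-addPart i []       = R.sym (R.zeroʳ (es (suc i)))
  sumᴾ-addPart i (p ∷ ps) = begin
    eᴾ (addPart i p) +ˢ sumᴾ (map (addPart i) ps)
      ≈⟨ R.+-cong (R.trans (product-insert (suc i) (parts p)) (R.*-congʳ {eᴾ p} (e≈es (suc i)))) (sumᴾ-addPart i ps) ⟩
    es (suc i) *ˢ eᴾ p +ˢ es (suc i) *ˢ sumᴾ ps ≈⟨ R.distribˡ (es (suc i)) (eᴾ p) (sumᴾ ps) ⟨
    es (suc i) *ˢ (eᴾ p +ˢ sumᴾ ps) ∎

  -- Coefficients are still encoded as repetitions in the list; `collect` merges them.
  EPos⇒sumᴾ : ∀ {f} → EPos f → ∃[ ps ] f ≈ sumᴾ ps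
  EPos⇒sumᴾ 1-pos = mkPartition [] [] [] ∷ [] , R.sym (R.+-identityʳ 1ˢ)
  EPos⇒sumᴾ 0-pos = [] , R.refl {0ˢ}
  EPos⇒sumᴾ (+-pos p q) =
    let ps , f≈ = EPos⇒sumᴾ p ; qs , g≈ = EPos⇒sumᴾ q
    in ps List.++ qs , R.trans (R.+-cong f≈ g≈) (R.sym (sumᴾ-++ ps qs))
  EPos⇒sumᴾ (es-pos i p) =
    let ps , f≈ = EPos⇒sumᴾ p
    in map (addPart i) ps , R.trans (R.*-congˡ {es (suc i)} f≈) (R.sym (sumᴾ-addPart i ps))
  EPos⇒sumᴾ (≈-pos f≈g p) = let ps , f≈ = EPos⇒sumᴾ p in ps , R.trans (R.sym f≈g) f≈

  -- The proof fields of `Partition` are irrelevant, so equality of the parts decides.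
  _≟ᴾ_ : (p q : Partition) → Dec (p ≡ q)
  mkPartition ps _ _ ≟ᴾ mkPartition qs _ _ with ≡-dec _≟_ ps qs
  ... | yes ≡.refl = yes ≡.refl
  ... | no  ps≢qs  = no (ps≢qs ∘ ≡.cong parts)

  Terms : Set
  Terms = List (ℤ × Partition)

  addTerm : Partition → Terms → Terms
  addTerm p []             = (1ℤ , p) ∷ []
  addTerm p ((c , q) ∷ ts) with p ≟ᴾ q
  ... | yes _ = (1ℤ ℤ.+ c , q) ∷ ts
  ... | no  _ = (c , q) ∷ addTerm p ts

  addTerm-≈ : ∀ p ts → linearCombination (addTerm p ts) ≈ eᴾ p +ˢ linearCombination ts
  addTerm-≈ p []             α = ≡.cong (ℤ._+ 0ℤ) (ℤₚ.*-identityˡ (eᴾ p α))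
  addTerm-≈ p ((c , q) ∷ ts) α with p ≟ᴾ q
  ... | yes ≡.refl = ≡.trans
    (≡.cong (ℤ._+ linearCombination ts α) (≡.trans (ℤₚ.*-distribʳ-+ (eᴾ p α) 1ℤ c)
      (≡.cong (ℤ._+ c ℤ.* eᴾ p α) (ℤₚ.*-identityˡ (eᴾ p α)))))
    (ℤₚ.+-assoc (eᴾ p α) (c ℤ.* eᴾ p α) (linearCombination ts α))
  ... | no _ = ≡.trans (+-congˡ {c ℤ.* eᴾ q α} (addTerm-≈ p ts α))
    (ℤ-+.x∙yz≈y∙xz (c ℤ.* eᴾ q α) (eᴾ p α) (linearCombination ts α))

  addTerm-fresh : ∀ {p q} ts → q ≢ p → All (q ≢_) (map proj₂ ts) → All (q ≢_) (map proj₂ (addTerm p ts))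
  addTerm-fresh []             q≢p [] = q≢p ∷ []
  addTerm-fresh {p} ((c , r) ∷ ts) q≢p (q≢r ∷ fresh) with p ≟ᴾ r
  ... | yes _ = q≢r ∷ fresh
  ... | no  _ = q≢r ∷ addTerm-fresh ts q≢p fresh

  addTerm-unique : ∀ p ts → Unique (map proj₂ ts) → Unique (map proj₂ (addTerm p ts))
  addTerm-unique p []             _ = [] ∷ []
  addTerm-unique p ((c , q) ∷ ts) (fresh ∷ unique) with p ≟ᴾ q
  ... | yes _   = fresh ∷ unique
  ... | no  p≢q = addTerm-fresh ts (≢-sym p≢q) fresh ∷ addTerm-unique p ts unique

  addTerm-nonneg : ∀ p ts → All (λ (c , _) → 0ℤ ℤ.≤ c) ts → All (λ (c , _) → 0ℤ ℤ.≤ c) (addTerm p ts)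
  addTerm-nonneg p []             _ = ℤ.+≤+ ℕ.z≤n ∷ []
  addTerm-nonneg p ((c , q) ∷ ts) (0≤c ∷ nonneg) with p ≟ᴾ q
  ... | yes _ = ℤₚ.+-mono-≤ {0ℤ} {1ℤ} {0ℤ} {c} (ℤ.+≤+ ℕ.z≤n) 0≤c ∷ nonneg
  ... | no  _ = 0≤c ∷ addTerm-nonneg p ts nonneg

  collect : ∀ ps → ∃[ ts ] Unique (map proj₂ ts) × sumᴾ ps ≈ linearCombination ts
    × All (λ (c , _) → 0ℤ ℤ.≤ c) ts
  collect []       = [] , [] , R.refl {0ˢ} , []
  collect (p ∷ ps) with collect ps
  ... | ts , unique , ps≈ts , nonneg = addTerm p ts , addTerm-unique p ts unique ,
    R.trans (R.+-congˡ {eᴾ p} ps≈ts) (R.sym (addTerm-≈ p ts)) , addTerm-nonneg p ts nonneg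

  EPos⇒EPositive : ∀ {n} (Γ : SimpleGraph n) → EPos (X Γ) → EPositive Γ
  EPos⇒EPositive Γ pos with ps , X≈ps ← EPos⇒sumᴾ pos with ts , unique , ps≈ts , nonneg ← collect ps =
    ts , unique , R.trans X≈ps ps≈ts , nonneg

corollary3p4 : (m l : ℕ) → 3 ≤ m → 1 ≤ l →
    (u v : Fin m) → SimpleGraph._~_ (cycle m) u v →
    (w : Fin l) → IsEnd w →
    EPositive (lineTadpole m l u v w)
corollary3p4 (suc zero)    _       (ℕ.s≤s ())
corollary3p4 (suc (suc j)) (suc l) _ _ u v (_ , uv) w w-end =
  -- Here m = j + 2, and `Y` takes m - 1 and the path length less one.
  EPos⇒EPositive (lineTadpole (suc (suc j)) (suc l) u v w)
    (≈-pos (R.sym (X-lineTadpole j l u v uv w w-end)) (Y-pos l (suc j)))
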